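{- The problem LSHom can be solved in polynomial time when $G$ has bounded treewidth and $G$ or $H$ has bounded maximum degree. That is, for all constants $t$ and $d$, there is a polynomial-time algorithm that decides, for given graphs $G$ and $H$ such that $G$ has treewidth at most $t$ and at least one of $G$, $H$ has maximum degree at most $d$, whether there exists a locally surjective homomorphism from $G$ to $H$.
   Context: All graphs are finite, undirected, and have neither self-loops nor multiple edges. For a graph $G=(V_G,E_G)$ and $u\in V_G$, let $N_G(u)=\{v\in V_G : uv\in E_G\}$; the maximum degree of $G$ is $\max_{u\in V_G}|N_G(u)|$. A homomorphism from $G$ to $H$ is a mapping $\varphi:V_G\to V_H$ with $\varphi(u)\varphi(v)\in E_H$ whenever $uv\in E_G$. It is locally surjective if for every $u\in V_G$ the restriction of $\varphi$ to $N_G(u)$, viewed as a mapping $N_G(u)\to N_H(\varphi(u))$, is surjective. LSHom is the decision problem that takes as input two graphs $G$ and $H$ (both part of the input) and asks whether there exists a locally surjective homomorphism from $G$ to $H$. A tree decomposition of $G$ is a tree $T$ whose nodes are subsets of $V_G$ such that: (1) each vertex of $G$ lies in some node; (2) for each edge $uv\in E_G$ some node contains both $u$ and $v$; (3) for each $v\in V_G$, the nodes containing $v$ induce a connected subtree of $T$. Its width is the size of a largest node minus one. The treewidth of $G$ is the minimum width over all tree decompositions of $G$. -}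

module Defs where

open import Data.Bool using (Bool; true; false; T)
open import Data.Fin using (Fin; zero)
open import Data.Fin.Subset using (Subset; _∈_; ∣_∣)
open import Data.List using (List; []; _∷_; _∷ʳ_; map; length; allFin)
open import Data.List.Extrema.Nat using (max)
open import Data.List.Relation.Unary.Linked using (Linked)
open import Data.List.Relation.Unary.Unique.Propositional using (Unique)
open import Data.Nat using (ℕ; suc; _+_; _*_; _^_; _∸_; _≤_)
open import Data.Product using (∃-syntax; _×_; _,_)
open import Data.Vec using (Vec; lookup; replicate; tabulate; _∷_; _[_]≔_)
open import Function.Definitions using (Injective)
open import Relation.Binary.Construct.Closure.ReflexiveTransitive using (Star)
open import Relation.Binary.PropositionalEquality using (_≡_)
open import Relation.Nullary using (¬_; Reflects)

------------------------------------------------------------------------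
-- Graphs

record Graph : Set where
  field
    order   : ℕ
    adj     : Fin order → Fin order → Bool
    adj-sym : ∀ u v → adj u v ≡ adj v u
    no-loop : ∀ u → adj u u ≡ false

  Vertex : Set
  Vertex = Fin order

  infix 4 _~_

  _~_ : Vertex → Vertex → Set
  u ~ v = T (adj u v)

  N : Vertex → Subset order
  N u = tabulate (adj u)

  degree : Vertex → ℕ
  degree u = ∣ N u ∣

  -- 0 for the graph without vertices.
  maxDegree : ℕ
  maxDegree = max 0 (map degree (allFin order))

  -- The subgraph induced by the vertices satisfying P is connected.
  ConnectedOn : (Vertex → Set) → Set
  ConnectedOn P = ∀ {u v} → P u → P v → Star (λ x y → P x × P y × x ~ y) u v

  Connected : Set
  Connected = ∀ u v → Star _~_ u v

  -- The cycle u , vs₀ , … , vsₖ , u, of length at least three.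
  IsCycle : Vertex → List Vertex → Set
  IsCycle u vs = 2 ≤ length vs × Unique (u ∷ vs) × Linked _~_ (u ∷ vs ∷ʳ u)

  record IsTree : Set where
    field
      nonempty  : Vertex
      connected : Connected
      acyclic   : ∀ u vs → ¬ IsCycle u vs

open Graph

------------------------------------------------------------------------
-- Locally surjective homomorphisms

IsHomomorphism : (G H : Graph) → (Vertex G → Vertex H) → Set
IsHomomorphism G H φ = ∀ {u v} → _~_ G u v → _~_ H (φ u) (φ v)

-- Every neighbour of φ u is the image of a neighbour of u.
IsLocallySurjective : (G H : Graph) → (Vertex G → Vertex H) → Set
IsLocallySurjective G H φ =
  ∀ u {w} → w ∈ N H (φ u) → ∃[ v ] (v ∈ N G u × φ v ≡ w)

LSHom : Graph × Graph → Set
LSHom (G , H) = ∃[ φ ] (IsHomomorphism G H φ × IsLocallySurjective G H φ)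

------------------------------------------------------------------------
-- Treewidth

record TreeDecomposition (G : Graph) : Set where
  field
    tree   : Graph
    isTree : IsTree tree
    bag    : Vertex tree → Subset (order G)

    -- The nodes of the tree are themselves subsets of the vertex set, so
    -- distinct nodes have distinct bags.
    bag-injective   : Injective _≡_ _≡_ bag
    covers-vertices : ∀ v → ∃[ x ] v ∈ bag x
    covers-edges    : ∀ {u v} → _~_ G u v → ∃[ x ] (u ∈ bag x × v ∈ bag x)
    subtrees        : ∀ v → ConnectedOn tree (λ x → v ∈ bag x)

  -- Truncated subtraction matters only for the graph without vertices, to
  -- which it gives width 0 rather than -1; no bound by a natural number
  -- is affected.
  width : ℕ
  width = max 0 (map (λ x → ∣ bag x ∣) (allFin (order tree))) ∸ 1

open TreeDecomposition

-- The minimum of the widths is at most t iff some width is.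
Treewidth≤ : ℕ → Graph → Set
Treewidth≤ t G = ∃[ D ] width {G} D ≤ t

------------------------------------------------------------------------
-- Model of computation
--
-- Jones' WHILE language on binary trees (Computability and Complexity: From
-- a Programming Perspective, MIT Press, 1997), without an equality test,
-- and with a conditional. Time counts the operations performed. A cons has
-- unit cost, as it does when trees are represented by shared pointers; an
-- answer is extracted only by unit-cost inspection, so the problems
-- decidable in polynomial time are the same as for Turing machines.

infixr 5 _∙_

data Tree : Set where
  nil : Tree
  _∙_ : Tree → Tree → Tree

size : Tree → ℕ
size nil     = 1
size (a ∙ b) = suc (size a + size b)

data Expr (k : ℕ) : Set where
  var   : Fin k → Expr k
  nil   : Expr k
  cons  : Expr k → Expr k → Expr k
  hd tl : Expr k → Expr k

infixr 4 _⨾_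
infixr 5 if_then_else_ while_loop_
infix  6 _≔_

data Command (k : ℕ) : Set where
  _≔_           : Fin k → Expr k → Command k
  _⨾_           : Command k → Command k → Command k
  if_then_else_ : Expr k → Command k → Command k → Command k
  while_loop_     : Expr k → Command k → Command k

Store : ℕ → Set
Store k = Vec Tree k

left right : Tree → Tree
left nil      = nil
left (a ∙ _)  = a
right nil     = nil
right (_ ∙ b) = b

eval : ∀ {k} → Expr k → Store k → Tree
eval (var x)    σ = lookup σ x
eval nil        σ = nil
eval (cons e f) σ = eval e σ ∙ eval f σ
eval (hd e)     σ = left (eval e σ)
eval (tl e)     σ = right (eval e σ)

cost : ∀ {k} → Expr k → ℕ
cost (var _)    = 1
cost nil        = 1
cost (cons e f) = suc (cost e + cost f)
cost (hd e)     = suc (cost e)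
cost (tl e)     = suc (cost e)

-- ⟨ c , σ ⟩⇓ τ [ t ]: started in store σ, the command c halts in store τ
-- after time t. As a condition, nil is false and all other trees are true.
infix 3 ⟨_,_⟩⇓_[_]

data ⟨_,_⟩⇓_[_] {k : ℕ} : Command k → Store k → Store k → ℕ → Set where

  assign : ∀ {x e σ} →
    ⟨ x ≔ e , σ ⟩⇓ σ [ x ]≔ eval e σ [ suc (cost e) ]

  seq : ∀ {c d σ τ υ s t} →
    ⟨ c , σ ⟩⇓ τ [ s ] →
    ⟨ d , τ ⟩⇓ υ [ t ] →
    ⟨ c ⨾ d , σ ⟩⇓ υ [ s + t ]

  if-true : ∀ {e c d σ τ a b t} →
    eval e σ ≡ a ∙ b →
    ⟨ c , σ ⟩⇓ τ [ t ] →
    ⟨ if e then c else d , σ ⟩⇓ τ [ suc (cost e + t) ]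

  if-false : ∀ {e c d σ τ t} →
    eval e σ ≡ nil →
    ⟨ d , σ ⟩⇓ τ [ t ] →
    ⟨ if e then c else d , σ ⟩⇓ τ [ suc (cost e + t) ]

  while-true : ∀ {e c σ τ υ a b s t} →
    eval e σ ≡ a ∙ b →
    ⟨ c , σ ⟩⇓ τ [ s ] →
    ⟨ while e loop c , τ ⟩⇓ υ [ t ] →
    ⟨ while e loop c , σ ⟩⇓ υ [ suc (cost e + s + t) ]

  while-false : ∀ {e c σ} →
    eval e σ ≡ nil →
    ⟨ while e loop c , σ ⟩⇓ σ [ suc (cost e) ]

-- Variable zero holds the input initially and the output finally; the other
-- variables are initially nil.
record Program : Set where
  field
    others : ℕ
    body   : Command (suc others)

open Program

_on_outputs_inTime_ : Program → Tree → Tree → ℕ → Set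
p on a outputs b inTime t =
  ∃[ τ ] (⟨ body p , a ∷ replicate (others p) nil ⟩⇓ τ [ t ]
          × lookup τ zero ≡ b)

------------------------------------------------------------------------
-- Encodings

encodeBool : Bool → Tree
encodeBool false = nil
encodeBool true  = nil ∙ nil

encodeList : List Tree → Tree
encodeList []       = nil
encodeList (a ∷ as) = a ∙ encodeList as

-- The adjacency matrix, as a list of rows.
encodeGraph : Graph → Tree
encodeGraph G = encodeList (map row (allFin (order G)))
  where
  row : Vertex G → Tree
  row u = encodeList (map (λ v → encodeBool (adj G u v)) (allFin (order G)))

encodeGraphs : Graph × Graph → Tree
encodeGraphs (G , H) = encodeGraph G ∙ encodeGraph H

------------------------------------------------------------------------
-- Polynomial time

-- p decides the question Q correctly, in time polynomial in the size of the
-- encoded instance, on all instances satisfying the restriction R.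
DecidesInPolynomialTime : {A : Set} → (A → Tree) →
  (R Q : A → Set) → Program → Set
DecidesInPolynomialTime encode R Q p =
  ∃[ c ] ∃[ k ] (∀ a → R a → ∃[ b ] ∃[ t ]
    ( p on encode a outputs encodeBool b inTime t
    × Reflects (Q a) b
    × t ≤ c * size (encode a) ^ k + c ))

PolynomialTimeDecidable : {A : Set} → (A → Tree) → (R Q : A → Set) → Set
PolynomialTimeDecidable encode R Q =
  ∃[ p ] DecidesInPolynomialTime encode R Q p

{-# OPTIONS --safe #-}
module Submission where

-- A locally surjective φ maps G into vertices of degree at most d, whichever
-- of the two graphs has bounded degree, so that at every vertex u of G the
-- value φ u and d pairs (v , φ v) witness local surjectivity. This makes the
-- problem a binary constraint satisfaction problem whose constraint graph is G
-- and whose domains are polynomial. It is solved by consistency: starting with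
-- all assignments to at most t + 1 vertices of G, delete an assignment if it is
-- inconsistent or if, for some set of at most t + 1 vertices, no remaining
-- assignment covers that set and agrees with it. The assignments obtained from
-- a solution are never deleted. Conversely, if some survive, choose one at each
-- node along a tree decomposition of G, agreeing with the one at the previous
-- node; together they form a solution. The tree decomposition serves in this
-- argument only and need not be computed.

open import Defs
open import Data.Bool using (Bool; true; false; T; T?)
open import Data.Bool.Properties using (T-≡)
open import Data.Empty using (⊥-elim)
open import Data.Fin using (Fin; zero; suc; toℕ; fromℕ<; _≟_)
open import Data.Fin.Properties using (toℕ<n; toℕ-fromℕ<; toℕ-injective)
open import Data.Fin.Subset using (Subset; ∣_∣) renaming (_∈_ to _∈ˢ_)
open import Data.List using (List; []; _∷_; _∷ʳ_; map; tabulate; length; allFin; concatMap)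
open import Data.List.Extrema.Nat using (max; xs≤max)
open import Data.List.Membership.Propositional using () renaming (_∈_ to _∈ˡ_)
open import Data.List.Membership.Propositional.Properties
  using (∈-allFin; ∈-map⁺; ∈-map⁻; ∈-concatMap⁺; ∈-concatMap⁻)
open import Data.List.Properties using (map-tabulate; tabulate-cong; length-map; length-++)
open import Data.List.Relation.Unary.All as All using (All; []; _∷_)
open import Data.List.Relation.Unary.AllPairs using ([]; _∷_)
open import Data.List.Relation.Unary.Any as Any using (Any; here; there; any?)
open import Data.List.Relation.Unary.Linked using (Linked; [-]; _∷_)
open import Data.List.Relation.Unary.Unique.Propositional using (Unique)
open import Data.Nat using (ℕ; zero; suc; _+_; _*_; _^_; _∸_; _≤_; _<_; z≤n; s≤s; z<s; s≤s⁻¹)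
open import Data.Nat.Properties hiding (_≟_)
open import Data.Product using (∃-syntax; _×_; _,_; proj₁; proj₂)
open import Data.Sum using (_⊎_; inj₁; inj₂; [_,_]′)
open import Data.Unit using (tt)
open import Data.Vec using ([]; _∷_; here; there)
open import Data.Vec.Properties using ([]=⇒lookup; lookup⇒[]=; lookup∘tabulate)
open import Function using (_∘_; id)
open import Function.Bundles using (_⇔_; mk⇔; Equivalence)
open import Relation.Binary.Construct.Closure.ReflexiveTransitive using (Star; ε; _◅_; _◅◅_; gmap)
open import Relation.Binary.PropositionalEquality
  using (_≡_; _≢_; refl; sym; trans; cong; subst; subst₂; module ≡-Reasoning)
open import Relation.Nullary using (¬_; Dec; yes; no; Reflects; ofʸ; ofⁿ)

-- Polynomial bounds

infixl 6 _⊕_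
infixl 7 _⊛_
infixr 9 _⊙_

-- Bounds are syntax, so that monotonicity and a dominating monomial come by recursion. Composition
-- is a constructor because the second of two programs is timed on the output of the first.
data Poly : Set where
  X   : Poly
  #_  : ℕ → Poly
  _⊕_ _⊛_ _⊙_ : Poly → Poly → Poly

⟦_⟧ : Poly → ℕ → ℕ
⟦ X ⟧     n = n
⟦ # c ⟧   n = c
⟦ p ⊕ q ⟧ n = ⟦ p ⟧ n + ⟦ q ⟧ n
⟦ p ⊛ q ⟧ n = ⟦ p ⟧ n * ⟦ q ⟧ n
⟦ p ⊙ q ⟧ n = ⟦ p ⟧ (⟦ q ⟧ n)

⟦⟧-mono : ∀ p {m n} → m ≤ n → ⟦ p ⟧ m ≤ ⟦ p ⟧ n
⟦⟧-mono X       m≤n = m≤n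
⟦⟧-mono (# c)   m≤n = ≤-refl
⟦⟧-mono (p ⊕ q) m≤n = +-mono-≤ (⟦⟧-mono p m≤n) (⟦⟧-mono q m≤n)
⟦⟧-mono (p ⊛ q) m≤n = *-mono-≤ (⟦⟧-mono p m≤n) (⟦⟧-mono q m≤n)
⟦⟧-mono (p ⊙ q) m≤n = ⟦⟧-mono p (⟦⟧-mono q m≤n)

coefficient degreeBound : Poly → ℕ
degreeBound X       = 1
degreeBound (# c)   = 0
degreeBound (p ⊕ q) = degreeBound p + degreeBound q
degreeBound (p ⊛ q) = degreeBound p + degreeBound q
degreeBound (p ⊙ q) = degreeBound q * degreeBound p
coefficient X       = 1
coefficient (# c)   = c
coefficient (p ⊕ q) = coefficient p + coefficient q
coefficient (p ⊛ q) = coefficient p * coefficient q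
coefficient (p ⊙ q) = coefficient p * suc (coefficient q) ^ degreeBound p

m^n≥1 : ∀ {m} n → 1 ≤ m → 1 ≤ m ^ n
m^n≥1 {suc m} n _ = m^n>0 (suc m) n

^-distribʳ-* : ∀ a b k → (a * b) ^ k ≡ a ^ k * b ^ k
^-distribʳ-* a b zero    = refl
^-distribʳ-* a b (suc k) = trans (cong (a * b *_) (^-distribʳ-* a b k)) ([m*n]*[o*p]≡[m*o]*[n*p] a b (a ^ k) (b ^ k))

-- For `1 ≤ n` powers grow with the exponent, so even for a sum it is safe to add the two degrees.
⟦⟧-bounded : ∀ p {n} → 1 ≤ n → ⟦ p ⟧ n ≤ coefficient p * n ^ degreeBound p
⟦⟧-bounded X {n} _ = ≤-reflexive (sym (trans (*-identityˡ _) (*-identityʳ n)))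
⟦⟧-bounded (# c) _ = ≤-reflexive (sym (*-identityʳ c))
⟦⟧-bounded (p ⊕ q) {suc n} h = begin
  ⟦ p ⟧ N + ⟦ q ⟧ N                              ≤⟨ +-mono-≤ (⟦⟧-bounded p h) (⟦⟧-bounded q h) ⟩
  coefficient p * N ^ j + coefficient q * N ^ k  ≤⟨ +-mono-≤ (*-monoʳ-≤ (coefficient p) (^-monoʳ-≤ N (m≤m+n j k)))
                                                             (*-monoʳ-≤ (coefficient q) (^-monoʳ-≤ N (m≤n+m k j))) ⟩
  coefficient p * N ^ (j + k) + coefficient q * N ^ (j + k)
                                                 ≡⟨ sym (*-distribʳ-+ (N ^ (j + k)) (coefficient p) (coefficient q)) ⟩
  (coefficient p + coefficient q) * N ^ (j + k)  ∎
  where open ≤-Reasoning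
        N = suc n
        j = degreeBound p
        k = degreeBound q
⟦⟧-bounded (p ⊛ q) {n} h = begin
  ⟦ p ⟧ n * ⟦ q ⟧ n                                  ≤⟨ *-mono-≤ (⟦⟧-bounded p h) (⟦⟧-bounded q h) ⟩
  (coefficient p * n ^ j) * (coefficient q * n ^ k)  ≡⟨ [m*n]*[o*p]≡[m*o]*[n*p] (coefficient p) (n ^ j) (coefficient q) (n ^ k) ⟩
  (coefficient p * coefficient q) * (n ^ j * n ^ k)  ≡⟨ cong (coefficient p * coefficient q *_) (sym (^-distribˡ-+-* n j k)) ⟩
  (coefficient p * coefficient q) * n ^ (j + k)      ∎
  where open ≤-Reasoning
        j = degreeBound p
        k = degreeBound q
⟦⟧-bounded (p ⊙ q) {n} h = begin
  ⟦ p ⟧ (⟦ q ⟧ n)                   ≤⟨ ⟦⟧-mono p (≤-trans (⟦⟧-bounded q h) (*-monoˡ-≤ (n ^ k) (n≤1+n (coefficient q)))) ⟩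
  -- The successor in `c` makes `c * n ^ k` at least 1, as the bound for `p` requires.
  ⟦ p ⟧ (c * n ^ k)                 ≤⟨ ⟦⟧-bounded p (*-mono-≤ (s≤s (z≤n {coefficient q})) (m^n≥1 k h)) ⟩
  coefficient p * (c * n ^ k) ^ j   ≡⟨ cong (coefficient p *_) (^-distribʳ-* c (n ^ k) j) ⟩
  coefficient p * (c ^ j * (n ^ k) ^ j)
                                    ≡⟨ cong (λ x → coefficient p * (c ^ j * x)) (^-*-assoc n k j) ⟩
  coefficient p * (c ^ j * n ^ (k * j))
                                    ≡⟨ sym (*-assoc (coefficient p) (c ^ j) _) ⟩
  coefficient p * c ^ j * n ^ (k * j) ∎
  where open ≤-Reasoning
        j = degreeBound p
        k = degreeBound q
        c = suc (coefficient q)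

-- Polynomial-time functions and their composition

-- A function computed in polynomial time and with polynomial growth. The code
-- keeps the argument in one register and leaves the stack in the other one as
-- it was, so that codes compose without renaming. Growth has to be tracked
-- separately from time, since sharing lets a unit-cost cons double the size.
record Fn : Set where
  field
    fun    : Tree → Tree
    code   : Command 2
    time   : Poly
    growth : Poly
    run    : ∀ a s → ∃[ t ] (⟨ code , a ∷ s ∷ [] ⟩⇓ fun a ∷ s ∷ [] [ t ] × t ≤ ⟦ time ⟧ (size a))
    grow   : ∀ a → size (fun a) ≤ ⟦ growth ⟧ (size a)

open Fn

pattern acc   = zero
pattern stack = suc zero

size≥1 : ∀ a → 1 ≤ size a
size≥1 nil     = ≤-refl
size≥1 (_ ∙ _) = s≤s z≤n

size-left : ∀ a → size (left a) ≤ size a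
size-left nil     = ≤-refl
size-left (a ∙ b) = m≤n⇒m≤1+n (m≤m+n (size a) (size b))

size-right : ∀ a → size (right a) ≤ size a
size-right nil     = ≤-refl
size-right (a ∙ b) = m≤n⇒m≤1+n (m≤n+m (size b) (size a))

idᶠ : Fn
idᶠ = record
  { fun = λ a → a ; code = acc ≔ var acc ; time = # 2 ; growth = X
  ; run = λ a s → _ , assign , ≤-refl ; grow = λ a → ≤-refl }

nilᶠ : Fn
nilᶠ = record
  { fun = λ a → nil ; code = acc ≔ nil ; time = # 2 ; growth = # 1
  ; run = λ a s → _ , assign , ≤-refl ; grow = λ a → ≤-refl }

hdᶠ : Fn
hdᶠ = record
  { fun = left ; code = acc ≔ hd (var acc) ; time = # 3 ; growth = X
  ; run = λ a s → _ , assign , ≤-refl ; grow = size-left }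

tlᶠ : Fn
tlᶠ = record
  { fun = right ; code = acc ≔ tl (var acc) ; time = # 3 ; growth = X
  ; run = λ a s → _ , assign , ≤-refl ; grow = size-right }

infixr 9 _∘ᶠ_
infixr 5 _∙ᶠ_

_∘ᶠ_ : Fn → Fn → Fn
g ∘ᶠ f = record
  { fun    = λ a → fun g (fun f a)
  ; code   = code f ⨾ code g
  ; time   = time f ⊕ time g ⊙ growth f
  ; growth = growth g ⊙ growth f
  ; run    = λ a s →
      let (t , r , t≤) = run f a s
          (u , q , u≤) = run g (fun f a) s
      in t + u , seq r q , +-mono-≤ t≤ (≤-trans u≤ (⟦⟧-mono (time g) (grow f a)))
  ; grow   = λ a → ≤-trans (grow g (fun f a)) (⟦⟧-mono (growth g) (grow f a)) }

_∙ᶠ_ : Fn → Fn → Fn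
f ∙ᶠ g = record
  { fun    = λ a → fun f a ∙ fun g a
  ; code   = stack ≔ cons (var acc) (var stack)
           ⨾ code f
           -- The value of `f` is slipped beneath the saved argument, which is then popped: `code g`
           -- finds the argument in `acc` and leaves that value on the stack.
           ⨾ stack ≔ cons (hd (var stack)) (cons (var acc) (tl (var stack)))
           ⨾ acc ≔ hd (var stack)
           ⨾ stack ≔ tl (var stack)
           ⨾ code g
           ⨾ acc ≔ cons (hd (var stack)) (var acc)
           ⨾ stack ≔ tl (var stack)
  ; time   = # 4 ⊕ (time f ⊕ (# 8 ⊕ (# 3 ⊕ (# 3 ⊕ (time g ⊕ # 8)))))
  ; growth = # 1 ⊕ (growth f ⊕ growth g)
  ; run    = λ a s →
      let (t , r , t≤) = run f a (a ∙ s)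
          (u , q , u≤) = run g a (fun f a ∙ s)
      in _ , seq assign (seq r (seq assign (seq assign (seq assign (seq q (seq assign assign))))))
       , +-monoʳ-≤ 4 (+-mono-≤ t≤ (+-monoʳ-≤ 14 (+-monoˡ-≤ 8 u≤)))
  ; grow   = λ a → s≤s (+-mono-≤ (grow f a) (grow g a)) }

branch : Tree → Tree → Tree → Tree
branch nil     x y = y
branch (_ ∙ _) x y = x

ifᶠ : Fn → Fn → Fn → Fn
ifᶠ f g h = record
  { fun    = λ a → branch (fun f a) (fun g a) (fun h a)
  ; code   = stack ≔ cons (var acc) (var stack)
           ⨾ code f
           ⨾ if var acc
             then (acc ≔ hd (var stack) ⨾ stack ≔ tl (var stack) ⨾ code g)
             else (acc ≔ hd (var stack) ⨾ stack ≔ tl (var stack) ⨾ code h)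
  -- The sum over both branches stands in for their maximum, which `Poly` cannot express.
  ; time   = # 12 ⊕ (time f ⊕ (time g ⊕ time h))
  ; growth = growth g ⊕ growth h
  ; run    = λ a s →
      let (t , r , t≤) = run f a (a ∙ s)
          (u , q , u≤) = cases a s
      in _ , seq assign (seq r q) , bound t≤ u≤
  ; grow   = λ a → size-branch (fun f a) (grow g a) (grow h a) }
  where
  size-branch : ∀ b {x y m n} → size x ≤ m → size y ≤ n → size (branch b x y) ≤ m + n
  size-branch nil     {m = m} p q = ≤-trans q (m≤n+m _ m)
  size-branch (_ ∙ _) {n = n} p q = ≤-trans p (m≤m+n _ n)

  cases : ∀ a s → ∃[ u ] (⟨ if var acc
             then (acc ≔ hd (var stack) ⨾ stack ≔ tl (var stack) ⨾ code g)
             else (acc ≔ hd (var stack) ⨾ stack ≔ tl (var stack) ⨾ code h)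
           , fun f a ∷ (a ∙ s) ∷ [] ⟩⇓ branch (fun f a) (fun g a) (fun h a) ∷ s ∷ [] [ u ]
           × u ≤ 8 + (⟦ time g ⟧ (size a) + ⟦ time h ⟧ (size a)))
  cases a s with fun f a
  ... | nil   = let (t , r , t≤) = run h a s in
    _ , if-false refl (seq assign (seq assign r)) , +-monoʳ-≤ 8 (≤-trans t≤ (m≤n+m _ _))
  ... | _ ∙ _ = let (t , r , t≤) = run g a s in
    _ , if-true refl (seq assign (seq assign r)) , +-monoʳ-≤ 8 (≤-trans t≤ (m≤m+n _ _))

  bound : ∀ {t u T U} → t ≤ T → u ≤ 8 + U → 4 + (t + u) ≤ 12 + (T + U)
  bound {t} {u} {T} {U} p q = begin
    4 + (t + u)        ≤⟨ +-monoʳ-≤ 4 (+-mono-≤ p q) ⟩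
    4 + (T + (8 + U))  ≡⟨ cong (4 +_) (trans (sym (+-assoc T 8 U)) (cong (_+ U) (+-comm T 8))) ⟩
    12 + (T + U)       ∎
    where open ≤-Reasoning

-- Loops over lists

foldT : (Tree → Tree → Tree) → Tree → Tree → Tree
foldT f nil     y = y
foldT f (x ∙ r) y = foldT f r (f x y)

-- The environment e, the rest r of the list and the accumulator y are related
-- by Inv throughout the loop, which keeps y of polynomial size.
module Fold
  (l z step : Fn) (B : Poly) (Inv : Tree → Tree → Tree → Set)
  (init  : ∀ e → Inv e (fun l e) (fun z e))
  (next  : ∀ {e x r y} → size (x ∙ r) ≤ ⟦ growth l ⟧ (size e) → Inv e (x ∙ r) y → Inv e r (fun step (x ∙ y ∙ e)))
  (bound : ∀ {e r y} → Inv e r y → size y ≤ ⟦ B ⟧ (size e))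
  where

  prepare : Fn
  prepare = l ∙ᶠ z ∙ᶠ idᶠ

  body : Command 2
  body = stack ≔ cons (cons (tl (hd (var acc))) (tl (tl (var acc)))) (var stack)
       ⨾ acc ≔ cons (hd (hd (var acc))) (tl (var acc))
       ⨾ code step
       ⨾ acc ≔ cons (hd (hd (var stack))) (cons (var acc) (tl (hd (var stack))))
       ⨾ stack ≔ tl (var stack)

  folded : Tree → Tree → Tree → Tree
  folded e = foldT (λ x y → fun step (x ∙ y ∙ e))

  iterationTime : Poly
  -- The constant 33 pays for the loop test and the four assignments around `code step`; the
  -- argument of `time step` bounds the size of `x ∙ y ∙ e`.
  iterationTime = # 33 ⊕ time step ⊙ (# 2 ⊕ (growth l ⊕ (B ⊕ X)))

  small : ∀ e {x r y} → Inv e (x ∙ r) y → size (x ∙ r) ≤ ⟦ growth l ⟧ (size e) →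
    size (x ∙ y ∙ e) ≤ 2 + (⟦ growth l ⟧ (size e) + (⟦ B ⟧ (size e) + size e))
  small e {x} {r} {y} i h = s≤s (begin
    size x + suc (size y + size e)  ≡⟨ +-suc (size x) _ ⟩
    suc (size x + (size y + size e))
      ≤⟨ s≤s (+-mono-≤ (≤-trans (m≤n⇒m≤1+n (m≤m+n (size x) (size r))) h) (+-monoˡ-≤ (size e) (bound i))) ⟩
    suc _ ∎)
    where open ≤-Reasoning

  -- Time is charged to the size of the list, not to its length: the final `nil` has size 1 and pays
  -- for the last, failing test.
  loops : ∀ e r y s → Inv e r y → size r ≤ ⟦ growth l ⟧ (size e) →
    ∃[ t ] (⟨ while hd (var acc) loop body , (r ∙ y ∙ e) ∷ s ∷ [] ⟩⇓ (nil ∙ folded e r y ∙ e) ∷ s ∷ [] [ t ]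
            × t ≤ size r * ⟦ iterationTime ⟧ (size e))
  loops e nil     y s i h = 3 , while-false refl , ≤-trans (m≤m+n 3 _) (m≤m+n _ 0)
  loops e (x ∙ r) y s i h =
    let (t , q , t≤) = run step (x ∙ y ∙ e) ((r ∙ e) ∙ s)
        (u , w , u≤) = loops e r _ s (next h i) (≤-trans (m≤n⇒m≤1+n (m≤n+m (size r) (size x))) h)
    in _ , while-true refl (seq assign (seq assign (seq q (seq assign assign)))) w
     , total t u (≤-trans t≤ (⟦⟧-mono (time step) (small e i h))) u≤
    where
    N = ⟦ iterationTime ⟧ (size e)
    total : ∀ t u → t ≤ ⟦ time step ⟧ _ → u ≤ size r * N →
      suc (2 + (10 + (7 + (t + (10 + 3)))) + u) ≤ size (x ∙ r) * N
    total t u p q = begin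
      20 + (t + 13) + u            ≡⟨ cong (λ m → 20 + m + u) (+-comm t 13) ⟩
      33 + t + u                   ≤⟨ +-mono-≤ (+-monoʳ-≤ 33 p) q ⟩
      N + size r * N               ≤⟨ +-monoʳ-≤ N (*-monoˡ-≤ N (m≤n+m (size r) (size x))) ⟩
      size (x ∙ r) * N             ∎
      where open ≤-Reasoning

  folded-size : ∀ e r y → Inv e r y → size r ≤ ⟦ growth l ⟧ (size e) → size (folded e r y) ≤ ⟦ B ⟧ (size e)
  folded-size e nil     y i h = bound i
  folded-size e (x ∙ r) y i h =
    folded-size e r _ (next h i) (≤-trans (m≤n⇒m≤1+n (m≤n+m (size r) (size x))) h)

  foldᶠ : Fn
  foldᶠ = record
    { fun    = λ e → folded e (fun l e) (fun z e)
    ; code   = code prepare ⨾ (while hd (var acc) loop body) ⨾ acc ≔ hd (tl (var acc))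
    ; time   = time prepare ⊕ (growth l ⊛ iterationTime ⊕ # 4)
    ; growth = B
    ; run    = λ e s →
        let (t , q , t≤) = run prepare e s
            (u , w , u≤) = loops e (fun l e) (fun z e) s (init e) (grow l e)
        in _ , seq q (seq w assign)
         , +-mono-≤ t≤ (+-monoˡ-≤ 4 (≤-trans u≤ (*-monoˡ-≤ _ (grow l e))))
    ; grow   = λ e → folded-size e _ _ (init e) (grow l e) }

-- Each step adds to the accumulator an amount that does not depend on it.
module AdditiveFold
  (l z step : Fn) (q : Poly)
  (additive : ∀ x y e → size (fun step (x ∙ y ∙ e)) ≤ size y + ⟦ q ⟧ (size (x ∙ e)))
  where

  increment : Poly
  increment = q ⊙ (growth l ⊕ X)

  total : Poly
  total = growth z ⊕ growth l ⊛ increment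

  -- A potential: the accumulator together with all that the remaining items may still add to it.
  Inv : Tree → Tree → Tree → Set
  Inv e r y = size y + size r * ⟦ increment ⟧ (size e) ≤ ⟦ total ⟧ (size e)

  next : ∀ {e x r y} → size (x ∙ r) ≤ ⟦ growth l ⟧ (size e) → Inv e (x ∙ r) y → Inv e r (fun step (x ∙ y ∙ e))
  next {e} {x} {r} {y} h i = begin
    size (fun step (x ∙ y ∙ e)) + size r * Q            ≤⟨ +-monoˡ-≤ (size r * Q) (additive x y e) ⟩
    size y + ⟦ q ⟧ (size (x ∙ e)) + size r * Q          ≤⟨ +-monoˡ-≤ (size r * Q) (+-monoʳ-≤ (size y) (⟦⟧-mono q x∙e≤)) ⟩
    size y + Q + size r * Q                             ≡⟨ +-assoc (size y) Q _ ⟩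
    size y + (Q + size r * Q)                           ≤⟨ +-monoʳ-≤ (size y) (+-monoʳ-≤ Q (*-monoˡ-≤ Q (m≤n+m (size r) (size x)))) ⟩
    size y + size (x ∙ r) * Q                           ≤⟨ i ⟩
    ⟦ total ⟧ (size e)                                  ∎
    where
    open ≤-Reasoning
    Q = ⟦ increment ⟧ (size e)
    x∙e≤ : size (x ∙ e) ≤ ⟦ growth l ⟧ (size e) + size e
    x∙e≤ = +-monoˡ-≤ (size e) (≤-trans (s≤s (m≤m+n (size x) (size r))) h)

  open Fold l z step total Inv
    (λ e → +-mono-≤ (grow z e) (*-monoˡ-≤ _ (grow l e)))
    next
    (λ {e} {r} {y} i → ≤-trans (m≤m+n (size y) _) i)
    public using (foldᶠ)

open Equivalence using (to; from)

decidable-by : {A : Set} {encode : A → Tree} {R Q : A → Set} (f : Fn) →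
  (∀ a → R a → ∃[ b ] (fun f (encode a) ≡ encodeBool b × Reflects (Q a) b)) →
  PolynomialTimeDecidable encode R Q
decidable-by {encode = encode} f correct =
  record { others = 1 ; body = code f } , coefficient (time f) , degreeBound (time f) , λ a r →
    let (b , fa≡b , reflects) = correct a r
        (t , q , t≤) = run f (encode a) nil
    in b , t , (_ , q , fa≡b) , reflects
     , ≤-trans t≤ (≤-trans (⟦⟧-bounded (time f) (size≥1 (encode a))) (m≤m+n _ _))

-- Truth values, lists and connectives

data True : Tree → Set where
  true : ∀ {a b} → True (a ∙ b)

¬True-nil : ¬ True nil
¬True-nil ()

true? : ∀ a → Dec (True a)
true? nil     = no λ ()
true? (_ ∙ _) = yes true

infix 4 _∈_

-- Every tree is read as a list along its right spine, as it also is by `len`.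
data _∈_ (x : Tree) : Tree → Set where
  here  : ∀ {r} → x ∈ x ∙ r
  there : ∀ {y r} → x ∈ r → x ∈ y ∙ r

len : Tree → ℕ
len nil     = 0
len (_ ∙ r) = suc (len r)

trueᶠ : Fn
trueᶠ = nilᶠ ∙ᶠ nilᶠ

notᶠ : Fn → Fn
notᶠ f = ifᶠ f nilᶠ trueᶠ

infixr 3 _∧ᶠ_ _⇒ᶠ_

_∧ᶠ_ _⇒ᶠ_ : Fn → Fn → Fn
f ∧ᶠ g = ifᶠ f g nilᶠ
f ⇒ᶠ g = ifᶠ f g trueᶠ

⇔-refl : ∀ {A : Set} → A ⇔ A
⇔-refl = mk⇔ id id

not-spec : ∀ f {a} {P : Set} → True (fun f a) ⇔ P → True (fun (notᶠ f) a) ⇔ (¬ P)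
not-spec f {a} h with fun f a
... | nil   = mk⇔ (λ _ p → ¬True-nil (from h p)) (λ _ → true)
... | _ ∙ _ = mk⇔ (λ ()) (λ ¬p → ⊥-elim (¬p (to h true)))

∧-spec : ∀ f g {a} {P Q : Set} → True (fun f a) ⇔ P → True (fun g a) ⇔ Q → True (fun (f ∧ᶠ g) a) ⇔ (P × Q)
∧-spec f g {a} h k with fun f a
... | nil   = mk⇔ (λ ()) (λ (p , _) → ⊥-elim (¬True-nil (from h p)))
... | _ ∙ _ = mk⇔ (λ q → to h true , to k q) (λ (_ , q) → from k q)

⇒-spec : ∀ f g {a} {P Q : Set} → True (fun f a) ⇔ P → True (fun g a) ⇔ Q → True (fun (f ⇒ᶠ g) a) ⇔ (P → Q)
⇒-spec f g {a} h k with fun f a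
... | nil   = mk⇔ (λ _ p → ⊥-elim (¬True-nil (from h p))) (λ _ → true)
... | _ ∙ _ = mk⇔ (λ q _ → to k q) (λ pq → from k (pq (to h true)))

-- A step of a loop over a list runs in the environment item ∙ accumulator ∙ rest.
withoutAcc : Fn
withoutAcc = hdᶠ ∙ᶠ (tlᶠ ∘ᶠ tlᶠ)

accᶠ : Fn
accᶠ = hdᶠ ∘ᶠ tlᶠ

-- Quantifiers and filters over lists

anyᶠ : Fn → Fn → Fn
anyᶠ l p = foldᶠ
  where
  additive : ∀ b y → size (branch b (nil ∙ nil) y) ≤ size y + 3
  additive nil     y = m≤m+n (size y) 3
  additive (_ ∙ _) y = m≤n+m 3 (size y)

  step : Fn
  step = ifᶠ (p ∘ᶠ withoutAcc) trueᶠ accᶠ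

  open AdditiveFold l nilᶠ step (# 3) (λ x y e → additive (fun p (x ∙ e)) y)

any-fold : ∀ (p : Tree → Tree) r y →
  True (foldT (λ x z → branch (p x) (nil ∙ nil) z) r y) ⇔ (True y ⊎ ∃[ x ] (x ∈ r × True (p x)))
any-fold p nil y = mk⇔ inj₁ λ { (inj₁ h) → h ; (inj₂ (_ , () , _)) }
any-fold p (x ∙ r) y with p x in px | any-fold p r (branch (p x) (nil ∙ nil) y)
... | nil | ih = mk⇔
  (λ h → [ inj₁ , (λ (z , z∈ , pz) → inj₂ (z , there z∈ , pz)) ]′ (to ih h))
  λ { (inj₁ h) → from ih (inj₁ h)
    ; (inj₂ (_ , here , h)) → ⊥-elim (¬True-nil (subst True px h))
    ; (inj₂ (z , there z∈ , pz)) → from ih (inj₂ (z , z∈ , pz)) }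
... | _ ∙ _ | ih = mk⇔
  (λ _ → inj₂ (x , here , subst True (sym px) true))
  (λ _ → from ih (inj₁ true))

any-spec : ∀ l p {a} {P : Tree → Set} → (∀ x → True (fun p (x ∙ a)) ⇔ P x) →
  True (fun (anyᶠ l p) a) ⇔ (∃[ x ] (x ∈ fun l a × P x))
any-spec l p {a} h = mk⇔
  (λ q → case (to (any-fold (λ x → fun p (x ∙ a)) (fun l a) nil) q))
  (λ (x , x∈ , px) → from (any-fold (λ x → fun p (x ∙ a)) (fun l a) nil) (inj₂ (x , x∈ , from (h x) px)))
  where
  case : True nil ⊎ _ → _
  case (inj₂ (x , x∈ , px)) = x , x∈ , to (h x) px

allᶠ : Fn → Fn → Fn
allᶠ l p = notᶠ (anyᶠ l (notᶠ p))

-- The test decides each `P x`, which is what allows the double negation in `allᶠ` to be removed.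
all-spec : ∀ l p {a} {P : Tree → Set} → (∀ x → True (fun p (x ∙ a)) ⇔ P x) →
  True (fun (allᶠ l p) a) ⇔ (∀ x → x ∈ fun l a → P x)
all-spec l p {a} {P} h = mk⇔
  (λ q x x∈ → holds x x∈ (to spec q))
  (λ q → from spec (λ (x , x∈ , ¬px) → ¬px (q x x∈)))
  where
  spec = not-spec (anyᶠ l (notᶠ p)) (any-spec l (notᶠ p) (λ x → not-spec p (h x)))
  holds : ∀ x → x ∈ fun l a → ¬ (∃[ x ] (x ∈ fun l a × ¬ P x)) → P x
  holds x x∈ ¬∃ with true? (fun p (x ∙ a))
  ... | yes px = to (h x) px
  ... | no ¬px = ⊥-elim (¬∃ (x , x∈ , λ px → ¬px (from (h x) px)))

keep : (Tree → Tree) → Tree → Tree → Tree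
keep p x y = branch (p x) (x ∙ y) y

filterᶠ : Fn → Fn → Fn
filterᶠ l p = foldᶠ
  where
  additive : ∀ b x y e → size (branch b (x ∙ y) y) ≤ size y + size (x ∙ e)
  additive nil     x y e = m≤m+n (size y) _
  additive (_ ∙ _) x y e = ≤-trans (≤-reflexive (cong suc (+-comm (size x) (size y))))
    (≤-trans (≤-reflexive (sym (+-suc (size y) (size x)))) (+-monoʳ-≤ (size y) (s≤s (m≤m+n (size x) (size e)))))

  step : Fn
  step = ifᶠ (p ∘ᶠ withoutAcc) (hdᶠ ∙ᶠ accᶠ) accᶠ

  open AdditiveFold l nilᶠ step X (λ x y e → additive (fun p (x ∙ e)) x y e)

filter-∈ : ∀ (p : Tree → Tree) r {x y} → x ∈ foldT (keep p) r y ⇔ (x ∈ y ⊎ x ∈ r × True (p x))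
filter-∈ p nil = mk⇔ inj₁ λ { (inj₁ h) → h ; (inj₂ (() , _)) }
filter-∈ p (z ∙ r) {x} {y} with p z in pz | filter-∈ p r {x} {keep p z y}
... | nil | ih = mk⇔
  (λ h → [ inj₁ , (λ (x∈ , px) → inj₂ (there x∈ , px)) ]′ (to ih h))
  λ { (inj₁ h) → from ih (inj₁ h)
    ; (inj₂ (here , h)) → ⊥-elim (¬True-nil (subst True pz h))
    ; (inj₂ (there x∈ , px)) → from ih (inj₂ (x∈ , px)) }
... | _ ∙ _ | ih = mk⇔
  (λ h → [ (λ { here → inj₂ (here , subst True (sym pz) true) ; (there h) → inj₁ h })
         , (λ (x∈ , px) → inj₂ (there x∈ , px)) ]′ (to ih h))
  λ { (inj₁ h) → from ih (inj₁ (there h))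
    ; (inj₂ (here , h)) → from ih (inj₁ here)
    ; (inj₂ (there x∈ , px)) → from ih (inj₂ (x∈ , px)) }

filter-spec : ∀ l p {a} {x} → x ∈ fun (filterᶠ l p) a ⇔ (x ∈ fun l a × True (fun p (x ∙ a)))
filter-spec l p {a} = mk⇔
  (λ h → [ (λ ()) , id ]′ (to (filter-∈ (λ x → fun p (x ∙ a)) (fun l a)) h))
  (λ h → from (filter-∈ (λ x → fun p (x ∙ a)) (fun l a)) (inj₂ h))

-- Started from `nil`, filtering yields a list no larger than the one filtered. Repeated filtering
-- is therefore an additive fold with increment zero.
size-filter : ∀ p r y → size (foldT (keep p) r y) < size r + size y
size-filter p nil y = ≤-refl
size-filter p (x ∙ r) y with p x
... | nil   = ≤-trans (size-filter p r y) (+-monoˡ-≤ (size y) (m≤n⇒m≤1+n (m≤n+m (size r) (size x))))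
... | _ ∙ _ = begin
  suc (size (foldT (keep p) r (x ∙ y)))  ≤⟨ size-filter p r (x ∙ y) ⟩
  size r + suc (size x + size y)         ≡⟨ +-suc (size r) _ ⟩
  suc (size r + (size x + size y))       ≡⟨ cong suc (sym (+-assoc (size r) (size x) (size y))) ⟩
  suc (size r + size x + size y)         ≡⟨ cong (λ m → suc (m + size y)) (+-comm (size r) (size x)) ⟩
  size (x ∙ r) + size y                  ∎
  where open ≤-Reasoning

len-filter : ∀ p r y → len (foldT (keep p) r y) ≤ len r + len y
len-filter p nil y = ≤-refl
len-filter p (x ∙ r) y with p x
... | nil   = m≤n⇒m≤1+n (len-filter p r y)
... | _ ∙ _ = ≤-trans (len-filter p r (x ∙ y)) (≤-reflexive (+-suc (len r) (len y)))

-- The progress measure for refinement: a round either finds nothing to delete or lowers the length.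
filter-shrinks : ∀ p r y → (∀ x → x ∈ r → True (p x)) ⊎ len (foldT (keep p) r y) < len r + len y
filter-shrinks p nil y = inj₁ λ _ ()
filter-shrinks p (x ∙ r) y with p x in px
... | nil   = inj₂ (s≤s (len-filter p r y))
... | _ ∙ _ with filter-shrinks p r (x ∙ y)
...   | inj₁ h = inj₁ λ { _ here → subst True (sym px) true ; z (there z∈) → h z z∈ }
...   | inj₂ h = inj₂ (≤-trans h (≤-reflexive (+-suc (len r) (len y))))

-- Products and lists of bounded length

-- Maps X ∙ Y to the list of the x ∙ y with x in X and y in Y.
prodᶠ : Fn
prodᶠ = Outer.foldᶠ
  where
  pairs-with-size : ∀ x r a → size (foldT (λ y b → (x ∙ y) ∙ b) r a) ≤ size a + size r * (2 + size x)
  pairs-with-size x nil a = m≤m+n (size a) _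
  pairs-with-size x (y ∙ r) a = begin
    size (foldT (λ y b → (x ∙ y) ∙ b) r ((x ∙ y) ∙ a))  ≤⟨ pairs-with-size x r ((x ∙ y) ∙ a) ⟩
    2 + (size x + size y) + size a + size r * c          ≡⟨ cong (_+ size r * c) (+-comm _ (size a)) ⟩
    size a + (c + size y) + size r * c                   ≡⟨ +-assoc (size a) _ _ ⟩
    size a + (c + size y + size r * c)                   ≡⟨ cong (size a +_) (+-assoc c (size y) _) ⟩
    size a + (c + (size y + size r * c))                 ≤⟨ +-monoʳ-≤ (size a) (+-monoʳ-≤ c (+-monoˡ-≤ (size r * c) (m≤m*n (size y) c))) ⟩
    size a + (c + (size y * c + size r * c))             ≡⟨ cong (λ m → size a + (c + m)) (sym (*-distribʳ-+ c (size y) (size r))) ⟩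
    size a + size (y ∙ r) * c                            ∎
    where open ≤-Reasoning
          c = 2 + size x

  innerStep : Fn
  innerStep = (hdᶠ ∘ᶠ tlᶠ ∘ᶠ tlᶠ ∙ᶠ hdᶠ) ∙ᶠ accᶠ

  inner-additive : ∀ y a e → size ((left e ∙ y) ∙ a) ≤ size a + suc (size (y ∙ e))
  inner-additive y a e = begin
    suc (suc (size (left e) + size y) + size a)  ≤⟨ s≤s (+-monoˡ-≤ (size a) (s≤s (+-monoˡ-≤ (size y) (size-left e)))) ⟩
    suc (suc (size e + size y) + size a)         ≡⟨ cong (λ m → suc (suc m + size a)) (+-comm (size e) (size y)) ⟩
    suc (size (y ∙ e)) + size a                  ≡⟨ +-comm _ (size a) ⟩
    size a + suc (size (y ∙ e))                  ∎
    where open ≤-Reasoning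

  -- The environment here is `x ∙ a ∙ A ∙ B`. The inner loop runs over `B` and starts from the
  -- accumulator `a` of the outer one, which takes the place of concatenation.
  module Inner = AdditiveFold (tlᶠ ∘ᶠ tlᶠ ∘ᶠ tlᶠ) accᶠ innerStep (# 1 ⊕ X) inner-additive

  outer-additive : ∀ x a e → size (foldT (λ y b → (x ∙ y) ∙ b) (right e) a) ≤ size a + size (x ∙ e) * (2 + size (x ∙ e))
  outer-additive x a e = ≤-trans (pairs-with-size x (right e) a) (+-monoʳ-≤ (size a) (*-mono-≤
    (≤-trans (size-right e) (m≤n⇒m≤1+n (m≤n+m (size e) (size x))))
    (+-monoʳ-≤ 2 (m≤n⇒m≤1+n (m≤m+n (size x) (size e))))))

  module Outer = AdditiveFold hdᶠ nilᶠ Inner.foldᶠ (X ⊛ (# 2 ⊕ X)) outer-additive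

prod-∈ : ∀ {x y A B} → x ∈ A → y ∈ B → x ∙ y ∈ fun prodᶠ (A ∙ B)
prod-∈ {x} {y} {A} {B} x∈ y∈ = outer nil x∈
  where
  grows : ∀ z C {a w} → w ∈ a → w ∈ foldT (λ y b → (z ∙ y) ∙ b) C a
  grows z nil     h = h
  grows z (v ∙ C) h = grows z C (there h)

  inner : ∀ {C} a → y ∈ C → x ∙ y ∈ foldT (λ y b → (x ∙ y) ∙ b) C a
  inner {_ ∙ C} a here      = grows x C here
  inner {_ ∙ C} a (there h) = inner _ h

  outer-grows : ∀ C {a w} → w ∈ a → w ∈ foldT (λ x a → foldT (λ y b → (x ∙ y) ∙ b) B a) C a
  outer-grows nil     h = h
  outer-grows (z ∙ C) h = outer-grows C (grows z B h)

  outer : ∀ {C} a → x ∈ C → x ∙ y ∈ foldT (λ x a → foldT (λ y b → (x ∙ y) ∙ b) B a) C a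
  outer {_ ∙ C} a here      = outer-grows C (inner a y∈)
  outer {_ ∙ C} a (there h) = outer _ h

prod-∈⁻ : ∀ A B {z} → z ∈ fun prodᶠ (A ∙ B) → ∃[ x ] ∃[ y ] (x ∈ A × y ∈ B × z ≡ x ∙ y)
prod-∈⁻ A B z∈ = [ id , (λ ()) ]′ (outer A nil z∈)
  where
  inner : ∀ x C a {z} → z ∈ foldT (λ y b → (x ∙ y) ∙ b) C a → (∃[ y ] (y ∈ C × z ≡ x ∙ y)) ⊎ z ∈ a
  inner x nil     a h = inj₂ h
  inner x (y ∙ C) a h with inner x C _ h
  ... | inj₁ (y′ , i , e) = inj₁ (y′ , there i , e)
  ... | inj₂ here         = inj₁ (y , here , refl)
  ... | inj₂ (there i)    = inj₂ i

  outer : ∀ C a {z} → z ∈ foldT (λ x a → foldT (λ y b → (x ∙ y) ∙ b) B a) C a →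
    (∃[ x ] ∃[ y ] (x ∈ C × y ∈ B × z ≡ x ∙ y)) ⊎ z ∈ a
  outer nil     a h = inj₂ h
  outer (x ∙ C) a h with outer C _ h
  ... | inj₁ (x′ , y , i , j , e) = inj₁ (x′ , y , there i , j , e)
  ... | inj₂ h′ with inner x B a h′
  ...   | inj₁ (y , j , e) = inj₁ (x , y , here , j , e)
  ...   | inj₂ i           = inj₂ i

-- The lists of at most `k` entries taken from the argument. The recursion on `k` builds the program
-- and is not performed by it, so for each fixed `k` the bounds are polynomials. This is where
-- constant `t` and `d` matter.
listsᶠ : ℕ → Fn
listsᶠ zero    = nilᶠ ∙ᶠ nilᶠ
listsᶠ (suc k) = nilᶠ ∙ᶠ prodᶠ ∘ᶠ (idᶠ ∙ᶠ listsᶠ k)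

lists-∈ : ∀ k {A xs} → All (_∈ A) xs → length xs ≤ k → encodeList xs ∈ fun (listsᶠ k) A
lists-∈ zero    []        z≤n     = here
lists-∈ (suc k) []        _       = here
lists-∈ (suc k) (x∈ ∷ h) (s≤s p) = there (prod-∈ x∈ (lists-∈ k h p))

lists-∈⁻ : ∀ k {A y} → y ∈ fun (listsᶠ k) A → len y ≤ k × (∀ {x} → x ∈ y → x ∈ A)
lists-∈⁻ zero    here = z≤n , λ ()
lists-∈⁻ (suc k) here = z≤n , λ ()
lists-∈⁻ (suc k) {A} (there h) with prod-∈⁻ A (fun (listsᶠ k) A) h
... | _ , _ , x∈ , l∈ , refl = let (short , inc) = lists-∈⁻ k {A} l∈ in
  s≤s short , λ { here → x∈ ; (there i) → inc i }

-- Lengths as numbers and access to adjacency matrices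

-- Removes the first `len a` entries of `b` from the input `a ∙ b`. As `right nil` is `nil`, lengths
-- are subtracted with truncation; comparison and indexing both rest on this.
dropᶠ : Fn
dropᶠ = foldᶠ
  where
  open AdditiveFold hdᶠ tlᶠ (tlᶠ ∘ᶠ accᶠ) (# 0)
    (λ x y e → ≤-trans (size-right y) (≤-reflexive (sym (+-identityʳ (size y)))))

len-drop : ∀ a b → len (fun dropᶠ (a ∙ b)) ≡ len b ∸ len a
len-drop nil     b = refl
len-drop (_ ∙ a) nil     = trans (len-drop a nil) (0∸n≡0 (len a))
len-drop (_ ∙ a) (_ ∙ b) = len-drop a b

true⇔len : ∀ {a} → True a ⇔ 0 < len a
true⇔len {nil}   = mk⇔ (λ ()) (λ ())
true⇔len {_ ∙ _} = mk⇔ (λ _ → z<s) (λ _ → true)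

-- Lengths are equal when both truncated differences vanish; the language itself has no equality
-- test.
eqᶠ : Fn → Fn → Fn
eqᶠ f g = notᶠ (dropᶠ ∘ᶠ (f ∙ᶠ g)) ∧ᶠ notᶠ (dropᶠ ∘ᶠ (g ∙ᶠ f))

eq-spec : ∀ f g {a} → True (fun (eqᶠ f g) a) ⇔ (len (fun f a) ≡ len (fun g a))
eq-spec f g {a} = mk⇔
  (λ h → let (p , q) = to spec h in ≤-antisym (≮⇒≥ (λ i → q (m<n⇒0<n∸m i))) (≮⇒≥ (λ i → p (m<n⇒0<n∸m i))))
  (λ e → from spec ( (λ i → <-irrefl e (m∸n≢0⇒n<m (>⇒≢ i))) , (λ i → <-irrefl (sym e) (m∸n≢0⇒n<m (>⇒≢ i)))))
  where
  positive : ∀ f g → True (fun (dropᶠ ∘ᶠ (f ∙ᶠ g)) a) ⇔ (0 < len (fun g a) ∸ len (fun f a))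
  positive f g = mk⇔
    (λ h → subst (0 <_) (len-drop (fun f a) (fun g a)) (to true⇔len h))
    (λ h → from true⇔len (subst (0 <_) (sym (len-drop (fun f a) (fun g a))) h))
  spec = ∧-spec (notᶠ (dropᶠ ∘ᶠ (f ∙ᶠ g))) (notᶠ (dropᶠ ∘ᶠ (g ∙ᶠ f)))
    (not-spec (dropᶠ ∘ᶠ (f ∙ᶠ g)) (positive f g)) (not-spec (dropᶠ ∘ᶠ (g ∙ᶠ f)) (positive g f))

adjᶠ : Fn → Fn → Fn → Fn
adjᶠ m f g = hdᶠ ∘ᶠ dropᶠ ∘ᶠ (g ∙ᶠ hdᶠ ∘ᶠ dropᶠ ∘ᶠ (f ∙ᶠ m))

Adj : Tree → Tree → Tree → Set
Adj M a b = True (left (fun dropᶠ (b ∙ left (fun dropᶠ (a ∙ M)))))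

nth-tabulate : ∀ {n} (f : Fin n → Tree) a u → len a ≡ toℕ u → left (fun dropᶠ (a ∙ encodeList (tabulate f))) ≡ f u
nth-tabulate f nil     zero    _ = refl
nth-tabulate f (_ ∙ a) (suc u) e = nth-tabulate (f ∘ suc) a u (suc-injective e)

encodeGraph-tabulate : ∀ G → encodeGraph G ≡
  encodeList (tabulate (λ u → encodeList (tabulate (λ v → encodeBool (Graph.adj G u v)))))
encodeGraph-tabulate G = cong encodeList (trans (map-tabulate id _)
  (tabulate-cong (λ u → cong encodeList (map-tabulate id (λ v → encodeBool (Graph.adj G u v))))))

true-encodeBool : ∀ {b} → True (encodeBool b) ⇔ T b
true-encodeBool {false} = mk⇔ (λ ()) (λ ())
true-encodeBool {true}  = mk⇔ (λ _ → tt) (λ _ → true)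

adj-spec : ∀ G a b {u v} → len a ≡ toℕ u → len b ≡ toℕ v → Adj (encodeGraph G) a b ⇔ Graph._~_ G u v
adj-spec G a b {u} {v} p q = subst (λ x → True x ⇔ _) (sym entry) true-encodeBool
  where
  entry : left (fun dropᶠ (b ∙ left (fun dropᶠ (a ∙ encodeGraph G)))) ≡ encodeBool (Graph.adj G u v)
  entry rewrite encodeGraph-tabulate G =
    trans (cong (λ r → left (fun dropᶠ (b ∙ r))) (nth-tabulate _ a u p)) (nth-tabulate _ b v q)

len-encodeGraph : ∀ G → len (encodeGraph G) ≡ Graph.order G
len-encodeGraph G rewrite encodeGraph-tabulate G = len-tabulate _
  where
  len-tabulate : ∀ {n} (f : Fin n → Tree) → len (encodeList (tabulate f)) ≡ n
  len-tabulate {zero}  f = refl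
  len-tabulate {suc n} f = cong suc (len-tabulate (f ∘ suc))

-- Enumeration of the vertices

-- A vertex is represented by any list whose length is its index. The proper
-- suffixes of the adjacency matrix are such lists.
verticesᶠ : Fn
verticesᶠ = foldᶠ
  where
  step : Fn
  step = ifᶠ accᶠ (tlᶠ ∘ᶠ hdᶠ ∘ᶠ accᶠ ∙ᶠ accᶠ) (tlᶠ ∘ᶠ tlᶠ ∘ᶠ tlᶠ ∙ᶠ nilᶠ)

  B : Poly
  B = # 1 ⊕ X ⊛ (# 1 ⊕ X)

  -- A step copies part of the accumulator, so its growth is not additive in the sense of
  -- `AdditiveFold`. The first component bounds the part copied, the second is the potential.
  Inv : Tree → Tree → Tree → Set
  Inv M r y = size (left y) ≤ size M × size y + size r * suc (size M) ≤ 1 + size M * suc (size M)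

  next : ∀ {M x r y} → size (x ∙ r) ≤ size M → Inv M (x ∙ r) y → Inv M r (branch y (right (left y) ∙ y) (right M ∙ nil))
  next {M} {x} {r} {y} _ (p , q) = head y p , (begin
    size y′ + size r * S        ≤⟨ +-monoˡ-≤ (size r * S) (longer y p) ⟩
    size y + S + size r * S     ≡⟨ +-assoc (size y) S _ ⟩
    size y + (S + size r * S)   ≤⟨ +-monoʳ-≤ (size y) (+-monoʳ-≤ S (*-monoˡ-≤ S (m≤n+m (size r) (size x)))) ⟩
    size y + size (x ∙ r) * S   ≤⟨ q ⟩
    1 + size M * S              ∎)
    where
    open ≤-Reasoning
    S = suc (size M)
    y′ = branch y (right (left y) ∙ y) (right M ∙ nil)
    head : ∀ y → size (left y) ≤ size M → size (left (branch y (right (left y) ∙ y) (right M ∙ nil))) ≤ size M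
    head nil     p = size-right M
    head (a ∙ _) p = ≤-trans (size-right a) p
    longer : ∀ y → size (left y) ≤ size M → size (branch y (right (left y) ∙ y) (right M ∙ nil)) ≤ size y + S
    longer nil     p = s≤s (≤-trans (+-monoˡ-≤ 1 (size-right M)) (≤-reflexive (+-comm (size M) 1)))
    longer (a ∙ b) p = ≤-trans (s≤s (+-monoˡ-≤ (size (a ∙ b)) (≤-trans (size-right a) p))) (≤-reflexive (+-comm S _))

  open Fold idᶠ nilᶠ step B Inv (λ M → size≥1 M , ≤-refl) (λ {e} {x} {r} {y} → next {e} {x} {r} {y})
    (λ {_} {r} {y} (_ , q) → ≤-trans (m≤m+n (size y) _) q)

len-right : ∀ a {n} → len a ≡ suc n → len (right a) ≡ n
len-right (_ ∙ _) = suc-injective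

-- The latest suffix, or `M` itself at the start, is as long as the list of remaining items. Hence
-- the indices from `len r` upwards are already listed, and all of them once `r` is exhausted.
vertices-fold : ∀ M r y →
  len (branch y (left y) M) ≡ len r →
  (∀ x → x ∈ y → len x < len M) →
  (∀ i → len r ≤ i → i < len M → ∃[ x ] (x ∈ y × len x ≡ i)) →
  let V = foldT (λ _ y → branch y (right (left y) ∙ y) (right M ∙ nil)) r y in
  (∀ x → x ∈ V → len x < len M) × (∀ i → i < len M → ∃[ x ] (x ∈ V × len x ≡ i))
vertices-fold M nil     y e below all = below , λ i → all i z≤n
vertices-fold M (_ ∙ r) nil e below all = vertices-fold M r (right M ∙ nil) (len-right M e)
  (λ { _ here → ≤-reflexive (trans (cong suc (len-right M e)) (sym e)) })
  (λ i r≤i i<M → right M , here , trans (len-right M e) (≤-antisym r≤i (s≤s⁻¹ (≤-trans i<M (≤-reflexive e)))))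
vertices-fold M (_ ∙ r) (a ∙ y) e below all = vertices-fold M r (right a ∙ a ∙ y) (len-right a e)
  (λ { _ here → ≤-trans (≤-trans (≤-reflexive (trans (cong suc (len-right a e)) (sym e))) (n≤1+n _)) (below a here)
     ; x (there x∈) → below x x∈ })
  λ i r≤i i<M → case i (m≤n⇒m<n∨m≡n r≤i) i<M
  where
  case : ∀ i → len r < i ⊎ len r ≡ i → i < len M → ∃[ x ] (x ∈ right a ∙ a ∙ y × len x ≡ i)
  case i (inj₂ eq)  _   = right a , here , trans (len-right a e) eq
  case i (inj₁ r<i) i<M = let (x , x∈ , q) = all i r<i i<M in x , there x∈ , q

vertices-spec : ∀ M → (∀ x → x ∈ fun verticesᶠ M → len x < len M)
  × (∀ i → i < len M → ∃[ x ] (x ∈ fun verticesᶠ M × len x ≡ i))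
vertices-spec M = vertices-fold M M nil refl (λ _ ()) (λ i p q → ⊥-elim (<-irrefl refl (<-≤-trans q p)))

vertices-below : ∀ M {x} → x ∈ fun verticesᶠ M → len x < len M
vertices-below M {x} = proj₁ (vertices-spec M) x

vertices-all : ∀ M {i} → i < len M → ∃[ x ] (x ∈ fun verticesᶠ M × len x ≡ i)
vertices-all M {i} = proj₂ (vertices-spec M) i

-- First-order formulas as programs

-- The entry at position i of an environment x₀ ∙ x₁ ∙ …, and the environment
-- from position i on.
var# from# : ℕ → Fn
var# zero     = hdᶠ
var# (suc i)  = var# i ∘ᶠ tlᶠ
from# zero    = idᶠ
from# (suc i) = from# i ∘ᶠ tlᶠ

-- A program and its meaning are built together, so that correctness of a composite test needs no
-- separate argument.
record Formula : Set₁ where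
  field
    test  : Fn
    Holds : Tree → Set
    spec  : ∀ a → True (fun test a) ⇔ Holds a

open Formula

infixr 3 _∧_
infixr 2 _⇒_
infix  4 _≐_
infixl 5 _[_]

_≐_ : Fn → Fn → Formula
f ≐ g = record { test = eqᶠ f g ; Holds = λ a → len (fun f a) ≡ len (fun g a) ; spec = λ a → eq-spec f g }

adjacent : Fn → Fn → Fn → Formula
adjacent m f g = record
  { test = adjᶠ m f g ; Holds = λ a → Adj (fun m a) (fun f a) (fun g a) ; spec = λ a → ⇔-refl }

_∧_ _⇒_ : Formula → Formula → Formula
φ ∧ ψ = record
  { test = test φ ∧ᶠ test ψ ; Holds = λ a → Holds φ a × Holds ψ a
  ; spec = λ a → ∧-spec (test φ) (test ψ) (spec φ a) (spec ψ a) }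
φ ⇒ ψ = record
  { test = test φ ⇒ᶠ test ψ ; Holds = λ a → Holds φ a → Holds ψ a
  ; spec = λ a → ⇒-spec (test φ) (test ψ) (spec φ a) (spec ψ a) }

-- The bound element goes to the front of the environment: positions are de Bruijn indices.
some every : Fn → Formula → Formula
some l φ = record
  { test = anyᶠ l (test φ) ; Holds = λ a → ∃[ x ] (x ∈ fun l a × Holds φ (x ∙ a))
  ; spec = λ a → any-spec l (test φ) (λ x → spec φ (x ∙ a)) }
every l φ = record
  { test = allᶠ l (test φ) ; Holds = λ a → ∀ x → x ∈ fun l a → Holds φ (x ∙ a)
  ; spec = λ a → all-spec l (test φ) (λ x → spec φ (x ∙ a)) }

_[_] : Formula → Fn → Formula
φ [ f ] = record { test = test φ ∘ᶠ f ; Holds = λ a → Holds φ (fun f a) ; spec = λ a → spec φ (fun f a) }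

-- States and their refinement

-- A triple u ∙ v ∙ w, recorded on behalf of the vertex u of G, asserts that
-- the vertex v of G is mapped to the vertex w of H. A state is a list of triples.
owner vertex image : Tree → Tree
owner  = left
vertex = left ∘ right
image  = right ∘ right

ownerᶠ vertexᶠ imageᶠ : Fn → Fn
ownerᶠ  f = hdᶠ ∘ᶠ f
vertexᶠ f = hdᶠ ∘ᶠ tlᶠ ∘ᶠ f
imageᶠ  f = tlᶠ ∘ᶠ tlᶠ ∘ᶠ f

infix 4 _≈_

_≈_ : Tree → Tree → Set
a ≈ b = len a ≡ len b

V : Tree → Tree
V = fun verticesᶠ

-- Membership up to length, since trees of equal length represent the same vertex.
Recorded : Tree → Tree → Set
Recorded τ s = ∃[ x ] (x ∈ s × owner x ≈ owner τ × vertex x ≈ vertex τ × image x ≈ image τ)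

-- Agreement forces the triples of an owner occurring in both states to be the
-- same in both.
Compatible : (G H s′ τ τ′ : Tree) → Set
Compatible G H s′ τ τ′ =
    (vertex τ ≈ vertex τ′ → image τ ≈ image τ′)
  × (Adj G (vertex τ) (vertex τ′) → Adj H (image τ) (image τ′))
  × (owner τ ≈ owner τ′ → Recorded τ s′)

Agree : (G H s s′ : Tree) → Set
Agree G H s s′ = ∀ τ → τ ∈ s → ∀ τ′ → τ′ ∈ s′ → Compatible G H s′ τ τ′

-- Local surjectivity at the vertices of `b`, certified by the state alone. A witness `v` may lie
-- outside `b`; its image is then asserted only on behalf of `u`.
Covers : (G H b s : Tree) → Set
Covers G H b s = ∀ u → u ∈ b → ∃[ a ] (a ∈ V H × Recorded (u ∙ u ∙ a) s ×
  (∀ w → w ∈ V H → Adj H a w → ∃[ v ] (v ∈ V G × Adj G u v × Recorded (u ∙ v ∙ w) s)))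

-- Agreement of `s` with itself is its consistency. Agreement with `s′` is asked both ways because
-- the clause of `Compatible` on owners is one-sided.
Supported : (j : ℕ) (G H R s : Tree) → Set
Supported j G H R s = Agree G H s s × (∀ b → b ∈ fun (listsᶠ j) (V G) →
  ∃[ s′ ] (s′ ∈ R × Covers G H b s′ × Agree G H s s′ × Agree G H s′ s))

-- The environments are `τ ∙ s` for `recorded`, `s ∙ s′ ∙ G ∙ H` for `agree`, `b ∙ s ∙ G ∙ H` for
-- `covers` and `s ∙ R ∙ G ∙ H` for `supported`. The graph `H` is the last tail and hence reached by
-- `from#`.
recorded : Formula
recorded = some tlᶠ (ownerᶠ (var# 0) ≐ ownerᶠ (var# 1)
                   ∧ vertexᶠ (var# 0) ≐ vertexᶠ (var# 1)
                   ∧ imageᶠ (var# 0) ≐ imageᶠ (var# 1))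

agree : Formula
agree = every (var# 0) (every (var# 2)
  (  (vertexᶠ τ ≐ vertexᶠ τ′ ⇒ imageᶠ τ ≐ imageᶠ τ′)
   ∧ (adjacent (var# 4) (vertexᶠ τ) (vertexᶠ τ′) ⇒ adjacent (from# 5) (imageᶠ τ) (imageᶠ τ′))
   ∧ (ownerᶠ τ ≐ ownerᶠ τ′ ⇒ recorded [ τ ∙ᶠ var# 3 ])))
  where
  τ = var# 1
  τ′ = var# 0

covers : Formula
covers = every (var# 0) (some (verticesᶠ ∘ᶠ from# 4)
  (  recorded [ (var# 1 ∙ᶠ var# 1 ∙ᶠ var# 0) ∙ᶠ var# 3 ]
   ∧ every (verticesᶠ ∘ᶠ from# 5) (adjacent (from# 6) (var# 1) (var# 0) ⇒ some (verticesᶠ ∘ᶠ var# 5)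
       (adjacent (var# 6) (var# 3) (var# 0) ∧ recorded [ (var# 3 ∙ᶠ var# 0 ∙ᶠ var# 1) ∙ᶠ var# 5 ]))))

-- j bounds the number of vertices in a bag.
supported : ℕ → Formula
supported j =
    agree [ var# 0 ∙ᶠ var# 0 ∙ᶠ from# 2 ]
  ∧ every (listsᶠ j ∘ᶠ verticesᶠ ∘ᶠ var# 2) (some (var# 2)
      (  covers [ var# 1 ∙ᶠ var# 0 ∙ᶠ from# 4 ]
       ∧ agree [ var# 2 ∙ᶠ var# 0 ∙ᶠ from# 4 ]
       ∧ agree [ var# 0 ∙ᶠ var# 2 ∙ᶠ from# 4 ]))

supported-spec : ∀ j G H R s → True (fun (test (supported j)) (s ∙ R ∙ G ∙ H)) ⇔ Supported j G H R s
supported-spec j G H R s = spec (supported j) (s ∙ R ∙ G ∙ H)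

supported-mono : ∀ j G H {R R′ s} → (∀ {x} → x ∈ R → x ∈ R′) → Supported j G H R s → Supported j G H R′ s
supported-mono j G H R⊆R′ (p , q) = p , λ b b∈ → let (s′ , s′∈ , r) = q b b∈ in s′ , R⊆R′ s′∈ , r

refineᶠ : ℕ → Fn
refineᶠ j = filterᶠ hdᶠ (test (supported j))

statesᶠ : ℕ → Fn
statesᶠ k = listsᶠ k ∘ᶠ prodᶠ ∘ᶠ (verticesᶠ ∘ᶠ hdᶠ ∙ᶠ prodᶠ ∘ᶠ (verticesᶠ ∘ᶠ hdᶠ ∙ᶠ verticesᶠ ∘ᶠ tlᶠ))

-- As many rounds as there are states suffice to reach a fixed point.
survivorsᶠ : ℕ → ℕ → Fn
survivorsᶠ j k = foldᶠ
  where
  open AdditiveFold (statesᶠ k) (statesᶠ k) (refineᶠ j ∘ᶠ tlᶠ) (# 0)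
    (λ x y e → ≤-trans (s≤s⁻¹ (≤-trans (size-filter _ y nil) (≤-reflexive (+-comm (size y) 1))))
                       (m≤m+n (size y) 0))

module _ (j : ℕ) (G H : Tree) where

  refine : Tree → Tree
  refine R = fun (refineᶠ j) (R ∙ G ∙ H)

  iterate : Tree → Tree → Tree
  iterate = foldT (λ _ → refine)

  Closed : Tree → Set
  Closed R = ∀ s → s ∈ R → Supported j G H R s

  refine-spec : ∀ {R s} → s ∈ refine R ⇔ (s ∈ R × True (fun (test (supported j)) (s ∙ R ∙ G ∙ H)))
  refine-spec {R} = filter-spec hdᶠ (test (supported j)) {R ∙ G ∙ H}

  refine-closed : ∀ {R} → Closed R → Closed (refine R)
  refine-closed {R} c s s∈ = supported-mono j G H
    (λ {x} x∈ → from (refine-spec {R}) (x∈ , from (supported-spec j G H R x) (c x x∈)))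
    (c s (proj₁ (to (refine-spec {R}) s∈)))

  -- Until a round deletes nothing, each one removes a state, so the rounds left always suffice to
  -- empty the list; the empty list is closed vacuously. Once closed, a list stays closed.
  iterate-closed : ∀ C {R} → len R ≤ len C ⊎ Closed R → Closed (iterate C R)
  iterate-closed nil     {nil} (inj₁ _) = λ _ ()
  iterate-closed nil           (inj₂ c) = c
  iterate-closed (_ ∙ C)       (inj₂ c) = iterate-closed C (inj₂ (refine-closed c))
  iterate-closed (_ ∙ C) {R}   (inj₁ h)
    with filter-shrinks (λ s → fun (test (supported j)) (s ∙ R ∙ G ∙ H)) R nil
  ... | inj₁ all = iterate-closed C (inj₂ (refine-closed λ s s∈ → to (supported-spec j G H R s) (all s s∈)))
  ... | inj₂ lt  = iterate-closed C (inj₁ (s≤s⁻¹ (≤-trans lt (≤-trans (≤-reflexive (+-identityʳ (len R))) h))))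

  -- Induction for a greatest fixed point: states that support one another within any list
  -- containing them all are never deleted.
  iterate-keeps : ∀ C {R} {P : Tree → Set} →
    (∀ {R} → (∀ {s} → P s → s ∈ R) → ∀ {s} → P s → Supported j G H R s) →
    (∀ {s} → P s → s ∈ R) → ∀ {s} → P s → s ∈ iterate C R
  iterate-keeps nil     closed P⊆R = P⊆R
  iterate-keeps (_ ∙ C) {R} closed P⊆R = iterate-keeps C closed λ {s} p →
    from (refine-spec {R}) (P⊆R p , from (supported-spec j G H R s) (closed P⊆R p))

  survivors : ℕ → Tree
  survivors k = fun (survivorsᶠ j k) (G ∙ H)

  survivors-closed : ∀ k → Closed (survivors k)
  survivors-closed k = iterate-closed (fun (statesᶠ k) (G ∙ H)) (inj₁ ≤-refl)

answerᶠ : ℕ → ℕ → Fn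
answerᶠ j k = ifᶠ (survivorsᶠ j k) trueᶠ nilᶠ

-- Extending choices along a tree

~-sym : ∀ (G : Graph) {u v} → Graph._~_ G u v → Graph._~_ G v u
~-sym G {u} {v} = subst T (Graph.adj-sym G u v)

~⇒≢ : ∀ (G : Graph) {u v} → Graph._~_ G u v → u ≢ v
~⇒≢ G {u} e refl = subst T (Graph.no-loop G u) e

module Growth (G : Graph) (tree : Graph.IsTree G) where
  open Graph G
  open IsTree tree

  data SimplePath (z : Vertex) : Vertex → List Vertex → Set where
    stop : SimplePath z z (z ∷ [])
    step : ∀ {x y vs} → x ~ y → All (x ≢_) vs → SimplePath z y vs → SimplePath z x (x ∷ vs)

  suffix : ∀ {x y z vs} {P : Vertex → Set} → SimplePath z y vs → All P vs → x ∈ˡ vs →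
    ∃[ us ] (SimplePath z x us × All P us)
  suffix p            a       (here refl) with p
  ... | stop       = _ , stop , a
  ... | step e n q = _ , step e n q , a
  suffix (step _ _ q) (_ ∷ a) (there i)   = suffix q a i

  -- Loop erasure: when the new first vertex already lies on the path, the path is cut back to it.
  simplify : ∀ {x z} {P : Vertex → Set} → P x → Star (λ a b → P a × P b × a ~ b) x z →
    ∃[ vs ] (SimplePath z x vs × All P vs)
  simplify px ε = _ , stop , px ∷ []
  simplify {x} px ((_ , py , e) ◅ w) with simplify py w
  ... | vs , q , a with any? (x ≟_) vs
  ...   | yes x∈ = suffix q a x∈
  ...   | no  x∉ = _ , step e (All.tabulate λ i x≡ → x∉ (subst (_∈ˡ vs) (sym x≡) i)) q , px ∷ a

  unique : ∀ {x z vs} → SimplePath z x vs → Unique vs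
  unique stop         = [] ∷ []
  unique (step _ n p) = n ∷ unique p

  linked : ∀ {x y z vs} → SimplePath z x vs → z ~ y → Linked _~_ (vs ∷ʳ y)
  linked stop                        f = f ∷ [-]
  linked (step e _ stop)             f = e ∷ f ∷ [-]
  linked (step e _ p@(step _ _ _))   f = e ∷ linked p f

  linked-from : ∀ {x y z vs} → y ~ x → SimplePath z x vs → z ~ y → Linked _~_ (y ∷ vs ∷ʳ y)
  linked-from e p@stop         f = e ∷ linked p f
  linked-from e p@(step _ _ _) f = e ∷ linked p f

  long : ∀ {x z vs} → x ≢ z → SimplePath z x vs → 2 ≤ length vs
  long x≢z stop                    = ⊥-elim (x≢z refl)
  long _   (step _ _ stop)         = s≤s (s≤s z≤n)
  long _   (step _ _ (step _ _ _)) = s≤s (s≤s z≤n)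

  -- Two distinct neighbours of y joined by a path avoiding y would close a cycle.
  unique-attachment : ∀ {x y z} {P : Vertex → Set} → ¬ P y → P x → y ~ x → y ~ z →
    Star (λ a b → P a × P b × a ~ b) x z → x ≡ z
  unique-attachment {x} {y} {z} {P} ¬py px e f w with x ≟ z
  ... | yes x≡z = x≡z
  ... | no  x≢z = let (vs , p , a) = simplify px w in
    ⊥-elim (acyclic y vs ( long x≢z p
                         , All.map (λ pv y≡v → ¬py (subst P (sym y≡v) pv)) a ∷ unique p
                         , linked-from e p (~-sym G f)))

  module _ {S : Set} (Good : Vertex → S → Set) (_≍_ : S → S → Set)
    (≍-sym  : ∀ {s s′} → s ≍ s′ → s′ ≍ s)
    (extend : ∀ {x s} y → Good x s → ∃[ s′ ] (Good y s′ × s ≍ s′))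
    where

    record Partial (W : List Vertex) : Set where
      field
        choice    : Vertex → S
        connects  : ConnectedOn (_∈ˡ W)
        good      : ∀ {x} → x ∈ˡ W → Good x (choice x)
        agreeing  : ∀ {x y} → x ∈ˡ W → y ∈ˡ W → x ~ y → choice x ≍ choice y

    open Partial

    -- Since `W` is connected, `unique-attachment` leaves `x` as the only neighbour of `y` in `W`.
    -- Agreement with the choice at `x`, which `extend` provides, is thus agreement with all
    -- neighbours.
    attach : ∀ {W x y} → Partial W → x ∈ˡ W → x ~ y → ¬ y ∈ˡ W → Partial (y ∷ W)
    attach {W} {x} {y} P x∈ e y∉ = record
      { choice = new ; connects = conn ; good = new-good ; agreeing = agr }
      where
      s′ : S
      s′ = proj₁ (extend y (good P x∈))

      pick : ∀ {z} → Dec (z ≡ y) → S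
      pick     (yes _) = s′
      pick {z} (no  _) = choice P z

      new : Vertex → S
      new z = pick (z ≟ y)

      new-y : new y ≡ s′
      new-y with y ≟ y
      ... | yes _ = refl
      ... | no ¬p = ⊥-elim (¬p refl)

      new-W : ∀ {z} → z ∈ˡ W → new z ≡ choice P z
      new-W {z} z∈ with z ≟ y
      ... | yes refl = ⊥-elim (y∉ z∈)
      ... | no _     = refl

      Step : List Vertex → Vertex → Vertex → Set
      Step U a b = a ∈ˡ U × b ∈ˡ U × a ~ b

      lift : ∀ {a b} → Star (Step W) a b → Star (Step (y ∷ W)) a b
      lift = gmap (λ a → a) (λ (p , q , r) → there p , there q , r)

      conn : ConnectedOn (_∈ˡ (y ∷ W))
      conn (here refl) (here refl) = ε
      conn (here refl) (there q)   = (here refl , there x∈ , ~-sym G e) ◅ lift (connects P x∈ q)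
      conn (there p)   (here refl) = lift (connects P p x∈) ◅◅ (there x∈ , here refl , e) ◅ ε
      conn (there p)   (there q)   = lift (connects P p q)

      new-good : ∀ {z} → z ∈ˡ (y ∷ W) → Good z (new z)
      new-good (here refl) = subst (Good y) (sym new-y) (proj₁ (proj₂ (extend y (good P x∈))))
      new-good (there z∈)  = subst (Good _) (sym (new-W z∈)) (good P z∈)

      only-x : ∀ {z} → z ∈ˡ W → y ~ z → new z ≍ new y
      only-x z∈ f with unique-attachment y∉ x∈ (~-sym G e) f (connects P x∈ z∈)
      ... | refl = subst₂ _≍_ (sym (new-W x∈)) (sym new-y) (proj₂ (proj₂ (extend y (good P x∈))))

      agr : ∀ {a b} → a ∈ˡ (y ∷ W) → b ∈ˡ (y ∷ W) → a ~ b → new a ≍ new b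
      agr (here refl) (here refl) f = ⊥-elim (~⇒≢ G f refl)
      agr (here refl) (there q)   f = ≍-sym (only-x q f)
      agr (there p)   (here refl) f = only-x p (~-sym G f)
      agr (there p)   (there q)   f = subst₂ _≍_ (sym (new-W p)) (sym (new-W q)) (agreeing P p q f)

    _⊇_ : List Vertex → List Vertex → Set
    U ⊇ W = ∀ {x} → x ∈ˡ W → x ∈ˡ U

    reach : ∀ {W x z} → Partial W → x ∈ˡ W → Star _~_ x z → ∃[ U ] (Partial U × U ⊇ W × z ∈ˡ U)
    reach P x∈ ε = _ , P , (λ i → i) , x∈
    reach {W} P x∈ (_◅_ {j = y} e w) with any? (y ≟_) W
    ... | yes y∈ = reach P y∈ w
    ... | no  y∉ = let (U , Q , inc , z∈) = reach (attach P x∈ e y∉) (here refl) w in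
      U , Q , (λ i → inc (there i)) , z∈

    reach-all : ∀ {W x} → Partial W → x ∈ˡ W → ∀ zs → ∃[ U ] (Partial U × U ⊇ W × All (_∈ˡ U) zs)
    reach-all P x∈ []       = _ , P , (λ i → i) , []
    reach-all P x∈ (z ∷ zs) =
      let (U , Q , inc , all) = reach-all P x∈ zs
          (U′ , Q′ , inc′ , z∈) = reach Q (inc x∈) (connected _ z)
      in U′ , Q′ , (λ i → inc′ (inc i)) , z∈ ∷ All.map inc′ all

    extend-over-tree : ∀ {s} → Good nonempty s →
      ∃[ p ] ((∀ x → Good x (p x)) × (∀ {x y} → x ~ y → p x ≍ p y))
    extend-over-tree {s} g =
      let (U , P , _ , all) = reach-all start (here refl) (allFin order)
          everywhere = λ x → All.lookup all (∈-allFin x)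
      in choice P , (λ x → good P (everywhere x)) , agreeing P (everywhere _) (everywhere _)
      where
      start : Partial (nonempty ∷ [])
      start = record
        { choice   = λ _ → s
        ; connects = λ { (here refl) (here refl) → ε }
        ; good     = λ { (here refl) → g }
        ; agreeing = λ { (here refl) (here refl) e → ⊥-elim (~⇒≢ G e refl) } }

-- Subsets, neighbourhoods and representatives of vertices

open Graph using (Vertex; order; adj; _~_; N; degree; maxDegree)

elements : ∀ {n} → Subset n → List (Fin n)
elements []          = []
elements (true ∷ p)  = zero ∷ map suc (elements p)
elements (false ∷ p) = map suc (elements p)

length-elements : ∀ {n} (p : Subset n) → length (elements p) ≡ ∣ p ∣
length-elements []          = refl
length-elements (true ∷ p)  = cong suc (trans (length-map suc (elements p)) (length-elements p))
length-elements (false ∷ p) = trans (length-map suc (elements p)) (length-elements p)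

∈-elements : ∀ {n} {p : Subset n} {u} → u ∈ˢ p → u ∈ˡ elements p
∈-elements {p = true  ∷ p} here      = here refl
∈-elements {p = true  ∷ p} (there i) = there (∈-map⁺ suc (∈-elements i))
∈-elements {p = false ∷ p} (there i) = ∈-map⁺ suc (∈-elements i)

∈N⇒~ : ∀ G {u v} → v ∈ˢ N G u → _~_ G u v
∈N⇒~ G {u} {v} i = from T-≡ (trans (sym (lookup∘tabulate (adj G u) v)) ([]=⇒lookup i))

~⇒∈N : ∀ G {u v} → _~_ G u v → v ∈ˢ N G u
~⇒∈N G {u} {v} e = lookup⇒[]= v (N G u) (trans (lookup∘tabulate (adj G u) v) (to T-≡ e))

max-map-bounds : ∀ {n} (f : Fin n → ℕ) x → f x ≤ max 0 (map f (allFin n))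
max-map-bounds f x = All.lookup (xs≤max 0 (map f (allFin _))) (∈-map⁺ f (∈-allFin x))

∈-encodeList⁺ : ∀ {x xs} → x ∈ˡ xs → x ∈ encodeList xs
∈-encodeList⁺ (here refl) = here
∈-encodeList⁺ (there i)   = there (∈-encodeList⁺ i)

∈-encodeList⁻ : ∀ {x} xs → x ∈ encodeList xs → x ∈ˡ xs
∈-encodeList⁻ (_ ∷ xs) here      = here refl
∈-encodeList⁻ (_ ∷ xs) (there i) = there (∈-encodeList⁻ xs i)

module Representation (G : Graph) where

  representative : ∀ u → ∃[ x ] (x ∈ V (encodeGraph G) × len x ≡ toℕ u)
  representative u = vertices-all (encodeGraph G) (subst (toℕ u <_) (sym (len-encodeGraph G)) (toℕ<n u))

  rep : Vertex G → Tree
  rep u = proj₁ (representative u)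

  rep-∈ : ∀ u → rep u ∈ V (encodeGraph G)
  rep-∈ u = proj₁ (proj₂ (representative u))

  len-rep : ∀ u → len (rep u) ≡ toℕ u
  len-rep u = proj₂ (proj₂ (representative u))

  index : ∀ {x} → x ∈ V (encodeGraph G) → Vertex G
  index {x} i = fromℕ< (subst (len x <_) (len-encodeGraph G) (vertices-below (encodeGraph G) i))

  len-index : ∀ {x} (i : x ∈ V (encodeGraph G)) → len x ≡ toℕ (index i)
  len-index i = sym (toℕ-fromℕ< _)

-- From a surviving state to a solution

module _ (G H : Graph) where

  private
    MG = encodeGraph G
    MH = encodeGraph H
    module RG = Representation G
    module RH = Representation H

  module Soundness {t : ℕ} (D : TreeDecomposition G) (w≤t : TreeDecomposition.width D ≤ t)
    {R : Tree} (closed : Closed (suc t) MG MH R) {s₀ : Tree} (s₀∈R : s₀ ∈ R) where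
    open TreeDecomposition D
    open Graph tree using () renaming (Vertex to Node; _~_ to _⌣_)

    bagTree : Node → Tree
    bagTree x = encodeList (map RG.rep (elements (bag x)))

    bagTree-∈ : ∀ x → bagTree x ∈ fun (listsᶠ (suc t)) (V MG)
    bagTree-∈ x = lists-∈ (suc t) (all (elements (bag x))) (begin
      length (map RG.rep (elements (bag x)))       ≡⟨ length-map RG.rep (elements (bag x)) ⟩
      length (elements (bag x))                    ≡⟨ length-elements (bag x) ⟩
      ∣ bag x ∣                                     ≤⟨ max-map-bounds (λ y → ∣ bag y ∣) x ⟩
      -- The inequality `m ≤ 1 + (m ∸ 1)` holds also where the subtraction in `width` truncates.
      max 0 (map (λ y → ∣ bag y ∣) (allFin _))      ≤⟨ m≤n+m∸n _ 1 ⟩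
      suc width                                    ≤⟨ s≤s w≤t ⟩
      suc t                                        ∎)
      where
      open ≤-Reasoning
      all : ∀ us → All (_∈ V MG) (map RG.rep us)
      all []       = []
      all (u ∷ us) = RG.rep-∈ u ∷ all us

    rep-∈-bagTree : ∀ {u x} → u ∈ˢ bag x → RG.rep u ∈ bagTree x
    rep-∈-bagTree i = ∈-encodeList⁺ (∈-map⁺ RG.rep (∈-elements i))

    Good : Node → Tree → Set
    Good x s = s ∈ R × Covers MG MH (bagTree x) s

    _≍_ : Tree → Tree → Set
    s ≍ s′ = Agree MG MH s s′ × Agree MG MH s′ s

    move : ∀ {s} → s ∈ R → ∀ x → ∃[ s′ ] (Good x s′ × s ≍ s′)
    move s∈ x = let (s′ , s′∈ , c , a , a′) = proj₂ (closed _ s∈) (bagTree x) (bagTree-∈ x)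
      in s′ , (s′∈ , c) , a , a′

    labelling : ∃[ p ] ((∀ x → Good x (p x)) × (∀ {x y} → x ⌣ y → p x ≍ p y))
    labelling = Growth.extend-over-tree tree isTree Good _≍_ (λ (a , a′) → a′ , a)
      (λ y (s∈ , _) → move s∈ y)
      -- The given survivor may fail to cover the first bag, so it is exchanged for one that does.
      (proj₁ (proj₂ (move s₀∈R (Graph.IsTree.nonempty isTree))))

    p : Node → Tree
    p = proj₁ labelling

    p∈R : ∀ x → p x ∈ R
    p∈R x = proj₁ (proj₁ (proj₂ labelling) x)

    own : ∀ {u x} → u ∈ˢ bag x → ∃[ a ] (a ∈ V MH × Recorded (RG.rep u ∙ RG.rep u ∙ a) (p x) ×
      (∀ w → w ∈ V MH → Adj MH a w → ∃[ v ] (v ∈ V MG × Adj MG (RG.rep u) v × Recorded (RG.rep u ∙ v ∙ w) (p x))))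
    own {u} {x} i = proj₂ (proj₁ (proj₂ labelling) x) (RG.rep u) (rep-∈-bagTree i)

    -- The nodes containing `v` are joined by a path of such nodes. At each of them `v` owns some
    -- triple, as `Covers` ensures, so the clause of `Compatible` on owners hands `τ` on along every
    -- edge.
    persists : ∀ {v x y} τ → v ∈ˢ bag x → v ∈ˢ bag y → owner τ ≈ RG.rep v →
      Recorded τ (p x) → Recorded τ (p y)
    persists {v} τ vx vy o = along (subtrees v vx vy)
      where
      along : ∀ {x y} → Star (λ x y → v ∈ˢ bag x × v ∈ˢ bag y × x ⌣ y) x y → Recorded τ (p x) → Recorded τ (p y)
      along ε r = r
      along ((_ , vz , e) ◅ w) (τ₀ , τ₀∈ , o₀ , q , r) =
        let (_ , _ , (τ′ , τ′∈ , o′ , _) , _) = own vz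
            a = proj₁ (proj₂ (proj₂ labelling) e)
            (τ₁ , τ₁∈ , o₁ , q₁ , r₁) = proj₂ (proj₂ (a τ₀ τ₀∈ τ′ τ′∈)) (trans o₀ (trans o (sym o′)))
        in along w (τ₁ , τ₁∈ , trans o₁ o₀ , trans q₁ q , trans r₁ r)

    home : Vertex G → Node
    home u = proj₁ (covers-vertices u)

    at-home : ∀ u → u ∈ˢ bag (home u)
    at-home u = proj₂ (covers-vertices u)

    value : Vertex G → Tree
    value u = proj₁ (own (at-home u))

    value-∈ : ∀ u → value u ∈ V MH
    value-∈ u = proj₁ (proj₂ (own (at-home u)))

    φ : Vertex G → Vertex H
    φ u = RH.index (value-∈ u)

    recorded-at : ∀ {u x} → u ∈ˢ bag x → Recorded (RG.rep u ∙ RG.rep u ∙ value u) (p x)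
    recorded-at {u} i = persists (RG.rep u ∙ RG.rep u ∙ value u) (at-home u) i refl (proj₁ (proj₂ (proj₂ (own (at-home u)))))

    -- The values of both ends are recorded at a node containing the edge, and the state there
    -- agrees with itself.
    hom : IsHomomorphism G H φ
    hom {u} {v} e =
      let (z , u∈z , v∈z) = covers-edges e
          (τ , τ∈ , _ , q , r) = recorded-at u∈z
          (τ′ , τ′∈ , _ , q′ , r′) = recorded-at v∈z
          c = proj₁ (closed _ (p∈R z)) τ τ∈ τ′ τ′∈
      in to (adj-spec H (image τ) (image τ′) (trans r (RH.len-index (value-∈ u))) (trans r′ (RH.len-index (value-∈ v))))
           (proj₁ (proj₂ c) (from (adj-spec G (vertex τ) (vertex τ′) (trans q (RG.len-rep u)) (trans q′ (RG.len-rep v))) e))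

    -- The witness `v` has image `w` on behalf of `u`, and image `value v` on its own behalf. At a
    -- node containing the edge both are recorded in one state, whose consistency identifies them.
    surjective : IsLocallySurjective G H φ
    surjective u {w} w∈ =
      let (v′ , v′∈ , e , r) = proj₂ (proj₂ (proj₂ (own (at-home u)))) (RH.rep w) (RH.rep-∈ w)
            (from (adj-spec H (value u) (RH.rep w) (RH.len-index (value-∈ u)) (RH.len-rep w)) (∈N⇒~ H w∈))
          v = RG.index v′∈
          u~v = to (adj-spec G (RG.rep u) v′ (RG.len-rep u) (RG.len-index v′∈)) e
          (z , u∈z , v∈z) = covers-edges u~v
          (τ , τ∈ , _ , q , i) = recorded-at v∈z
          (τ′ , τ′∈ , _ , q′ , i′) = persists (RG.rep u ∙ v′ ∙ RH.rep w) (at-home u) u∈z refl r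
          c = proj₁ (closed _ (p∈R z)) τ τ∈ τ′ τ′∈
          same = trans q (trans (RG.len-rep v) (trans (sym (RG.len-index v′∈)) (sym q′)))
      in v , ~⇒∈N G u~v , toℕ-injective
           (trans (sym (RH.len-index (value-∈ v))) (trans (sym i)
             (trans (proj₁ c same) (trans i′ (RH.len-rep w)))))

    solution : LSHom (G , H)
    solution = φ , (λ {u} {v} → hom {u} {v}) , λ u {w} → surjective u {w}

  -- From a solution to surviving states

  module Completeness {t d : ℕ} (φ : Vertex G → Vertex H) (hom : IsHomomorphism G H φ)
    (witnesses : Vertex G → List (Vertex G)) (few : ∀ u → length (witnesses u) ≤ d)
    (enough : ∀ u w → _~_ H (φ u) w → ∃[ v ] (v ∈ˡ witnesses u × _~_ G u v × φ v ≡ w))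
    where

    triple : Vertex G → Vertex G → Tree
    triple u v = RG.rep u ∙ RG.rep v ∙ RH.rep (φ v)

    triples : Vertex G → List Tree
    triples u = map (triple u) (u ∷ witnesses u)

    stateOf : List (Vertex G) → Tree
    stateOf us = encodeList (concatMap triples us)

    stateOf⁺ : ∀ {us u v} → u ∈ˡ us → v ∈ˡ (u ∷ witnesses u) → triple u v ∈ stateOf us
    stateOf⁺ {us} {u} i j = ∈-encodeList⁺ (∈-concatMap⁺ triples (Any.map (λ { refl → ∈-map⁺ (triple u) j }) i))

    stateOf⁻ : ∀ us {τ} → τ ∈ stateOf us → ∃[ u ] ∃[ v ] (u ∈ˡ us × v ∈ˡ (u ∷ witnesses u) × τ ≡ triple u v)
    stateOf⁻ us i = find us (∈-concatMap⁻ triples {xs = us} (∈-encodeList⁻ _ i))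
      where
      find : ∀ us {τ} → Any (λ u → τ ∈ˡ triples u) us →
        ∃[ u ] ∃[ v ] (u ∈ˡ us × v ∈ˡ (u ∷ witnesses u) × τ ≡ triple u v)
      find (u ∷ us) (here h)  = let (v , j , e) = ∈-map⁻ (triple u) h in u , v , here refl , j , e
      find (_ ∷ us) (there i) = let (u , v , i′ , j , e) = find us i in u , v , there i′ , j , e

    length-states : ∀ us → length (concatMap triples us) ≤ length us * suc d
    length-states []       = z≤n
    length-states (u ∷ us) = begin
      length (concatMap triples (u ∷ us))                     ≡⟨ length-++ (triples u) ⟩
      length (triples u) + length (concatMap triples us)      ≤⟨ +-mono-≤
        (s≤s (≤-trans (≤-reflexive (length-map (triple u) (witnesses u))) (few u))) (length-states us) ⟩
      suc d + length us * suc d                               ∎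
      where open ≤-Reasoning

    rep-injective : ∀ {u v} → RG.rep u ≈ RG.rep v → u ≡ v
    rep-injective {u} {v} e = toℕ-injective (trans (sym (RG.len-rep u)) (trans e (RG.len-rep v)))

    -- All triples report values of the one homomorphism `φ`, so they cannot conflict. What `u` owns
    -- depends on `u` alone, hence a common owner has the same triples in both states.
    agrees : ∀ us us′ → Agree MG MH (stateOf us) (stateOf us′)
    agrees us us′ τ i τ′ i′ with stateOf⁻ us i | stateOf⁻ us′ i′
    ... | u , v , u∈ , v∈ , refl | u′ , v′ , u′∈ , v′∈ , refl =
        (λ e → cong (len ∘ RH.rep ∘ φ) (rep-injective e))
      , (λ e → from (adj-spec H (RH.rep (φ v)) (RH.rep (φ v′)) (RH.len-rep (φ v)) (RH.len-rep (φ v′)))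
                 (hom (to (adj-spec G (RG.rep v) (RG.rep v′) (RG.len-rep v) (RG.len-rep v′)) e)))
      , (λ e → triple u v
             , stateOf⁺ (subst (_∈ˡ us′) (sym (rep-injective e)) u′∈) v∈ , refl , refl , refl)

    covered : ∀ b us → (∀ x → x ∈ b → ∃[ u ] (u ∈ˡ us × len x ≡ toℕ u)) → Covers MG MH b (stateOf us)
    covered b us h x x∈ =
      let (u , u∈ , e) = h x x∈
          e′ = trans (RG.len-rep u) (sym e)
      in RH.rep (φ u) , RH.rep-∈ (φ u) , (triple u u , stateOf⁺ u∈ (here refl) , e′ , e′ , refl) , λ w w∈ a →
        let (v , v∈ , u~v , φv≡w) = enough u (RH.index w∈) (to (adj-spec H (RH.rep (φ u)) w (RH.len-rep (φ u)) (RH.len-index w∈)) a)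
        in RG.rep v , RG.rep-∈ v , from (adj-spec G x (RG.rep v) e (RG.len-rep v)) u~v
         , (triple u v , stateOf⁺ u∈ (there v∈) , e′ , refl
           , trans (RH.len-rep (φ v)) (trans (cong toℕ φv≡w) (sym (RH.len-index w∈))))

    indices : ∀ b {k} → len b ≤ k → (∀ {x} → x ∈ b → x ∈ V MG) →
      ∃[ us ] (length us ≤ k × (∀ x → x ∈ b → ∃[ u ] (u ∈ˡ us × len x ≡ toℕ {order G} u)))
    indices nil     _       _ = [] , z≤n , λ _ ()
    indices (x ∙ b) (s≤s l) h =
      let (us , l′ , f) = indices b l (h ∘ there)
      in RG.index (h here) ∷ us , s≤s l′
       , λ { _ here → _ , here refl , RG.len-index (h here)
           ; y (there i) → let (u , i′ , e) = f y i in u , there i′ , e }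

    Truthful : Tree → Set
    Truthful s = ∃[ us ] (length us ≤ suc t × s ≡ stateOf us)

    -- A required list `b` is covered by the truthful state of its own vertices, of which there are
    -- at most `t + 1`.
    truthful-supported : ∀ {R} → (∀ {s} → Truthful s → s ∈ R) → ∀ {s} → Truthful s → Supported (suc t) MG MH R s
    truthful-supported T⊆R (us , _ , refl) = agrees us us , λ b b∈ →
      let (l , inc) = lists-∈⁻ (suc t) b∈
          (us′ , l′ , h) = indices b l inc
      in stateOf us′ , T⊆R (us′ , l′ , refl) , covered b us′ h , agrees us us′ , agrees us′ us

    truthful-state : ∀ {s} → Truthful s → s ∈ fun (statesᶠ (suc t * suc d)) (MG ∙ MH)
    truthful-state (us , l , refl) = lists-∈ (suc t * suc d) (all us)
      (≤-trans (length-states us) (*-monoˡ-≤ (suc d) l))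
      where
      A = fun prodᶠ (V MG ∙ fun prodᶠ (V MG ∙ V MH))
      all : ∀ us → All (_∈ A) (concatMap triples us)
      all us = All.tabulate λ i → let (u , v , _ , _ , e) = stateOf⁻ us (∈-encodeList⁺ i) in
        subst (_∈ A) (sym e) (prod-∈ (RG.rep-∈ u) (prod-∈ (RG.rep-∈ v) (RH.rep-∈ (φ v))))

    -- `nil` is the truthful state of no vertices, so it survives even if `G` has none.
    nil-survives : nil ∈ survivors (suc t) MG MH (suc t * suc d)
    nil-survives = iterate-keeps (suc t) MG MH (fun (statesᶠ (suc t * suc d)) (MG ∙ MH))
      truthful-supported truthful-state ([] , z≤n , refl)

-- Bounding the witnesses, and the decision procedure

few-witnesses : ∀ {d} G H → maxDegree G ≤ d ⊎ maxDegree H ≤ d → (φ : Vertex G → Vertex H) →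
  IsHomomorphism G H φ → IsLocallySurjective G H φ →
  ∃[ witnesses ] ((∀ u → length (witnesses u) ≤ d)
    × (∀ u w → _~_ H (φ u) w → ∃[ v ] (v ∈ˡ witnesses u × _~_ G u v × φ v ≡ w)))
few-witnesses {d} G H (inj₁ Δ≤d) φ hom surjective =
    (λ u → elements (N G u))
  , (λ u → ≤-trans (≤-reflexive (length-elements (N G u))) (≤-trans (max-map-bounds (degree G) u) Δ≤d))
  , λ u w e → let (v , v∈ , q) = surjective u (~⇒∈N H e) in v , ∈-elements v∈ , ∈N⇒~ G v∈ , q
-- Here `u` may have many neighbours; one preimage is chosen for each neighbour of `φ u`.
few-witnesses {d} G H (inj₂ Δ≤d) φ hom surjective =
    (λ u → map (lift u) (elements (N H (φ u))))
  , (λ u → ≤-trans (≤-reflexive (trans (length-map (lift u) (elements (N H (φ u)))) (length-elements (N H (φ u)))))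
                   (≤-trans (max-map-bounds (degree H) (φ u)) Δ≤d))
  , λ u w e → let (u~v , φv≡w) = lift-correct u w e
      in lift u w , ∈-map⁺ (lift u) (∈-elements (~⇒∈N H e)) , u~v , φv≡w
  where
  lift : Vertex G → Vertex H → Vertex G
  lift u w with T? (adj H (φ u) w)
  ... | yes e = proj₁ (surjective u (~⇒∈N H e))
  -- A default value: `lift u` is applied only to neighbours of `φ u`.
  ... | no  _ = u

  lift-correct : ∀ u w → _~_ H (φ u) w → _~_ G u (lift u w) × φ (lift u w) ≡ w
  lift-correct u w e with T? (adj H (φ u) w)
  ... | yes e′ = let (v , v∈ , q) = surjective u (~⇒∈N H e′) in ∈N⇒~ G v∈ , q
  ... | no ¬e  = ⊥-elim (¬e e)

nonempty-reflects : ∀ R {P : Set} → (∀ {s} → s ∈ R → P) → (P → nil ∈ R) →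
  ∃[ b ] (branch R (nil ∙ nil) nil ≡ encodeBool b × Reflects P b)
nonempty-reflects nil     _ g = false , refl , ofⁿ λ p → case (g p)
  where
  case : ¬ nil ∈ nil
  case ()
nonempty-reflects (_ ∙ _) f _ = true , refl , ofʸ (f here)

theorem4 : (t d : ℕ) →
    PolynomialTimeDecidable encodeGraphs
    (λ (G , H) → Treewidth≤ t G × (Graph.maxDegree G ≤ d ⊎ Graph.maxDegree H ≤ d))
    LSHom
-- A state has at most `t + 1` owners, each with one triple for itself and at most `d` for its
-- witnesses.
theorem4 t d = decidable-by (answerᶠ (suc t) (suc t * suc d)) λ (G , H) ((D , w≤t) , Δ≤d) →
  let k = suc t * suc d
      R = survivors (suc t) (encodeGraph G) (encodeGraph H) k
      closed = survivors-closed (suc t) (encodeGraph G) (encodeGraph H) k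
  in nonempty-reflects R
       (Soundness.solution G H D w≤t closed)
       (λ (φ , hom , surjective) →
          let (witnesses , few , enough) = few-witnesses G H Δ≤d φ hom surjective
          in Completeness.nil-survives G H {t} {d} φ hom witnesses few enough)
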